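{- Let $G$ be a graph and let $r$ be an integer with $0<r\le\lfloor e(G)/2\rfloor$. Then $G$ is $r$-tonal if and only if $G$ has both a partition $V(G)=X\cup Y$ and a set of vertices $W\subseteq V(G)$ such that $e(X,Y),\, e(G[W])\in\{r,\,e(G)-r\}$.
   Context: Graphs are finite and simple; $e(G)=|E(G)|$; for a partition $V(G)=X\cup Y$ (disjoint parts, possibly empty), $e(X,Y)$ is the number of edges with one end in $X$ and the other in $Y$; $G[W]$ is the subgraph induced by $W$. A $2$-coloring $E(K_n)=E(R)\cup E(B)$ is a partition of the edges of $K_n$ into red edges (forming $R$) and blue edges (forming $B$). An $(r,b)$-colored copy of $G$ (with $r+b=e(G)$) is a (not necessarily induced) subgraph of $K_n$ isomorphic to $G$ with exactly $r$ red and $b$ blue edges. For an integer $r$ with $0<r\le\lfloor e(G)/2\rfloor$, ${\rm bal}_r(n,G)$ is the minimum non-negative integer $s$ such that every $2$-coloring $E(K_n)=E(R)\cup E(B)$ with $\min\{e(R),e(B)\}>s$ contains an $(r,e(G)-r)$-colored copy of $G$ or an $(e(G)-r,r)$-colored copy of $G$. The graph $G$ is $r$-tonal if for every sufficiently large $n$ such an integer exists non-vacuously, that is, ${\rm bal}_r(n,G)<\lfloor\frac12\binom n2\rfloor$ (so that there are colorings with $\min\{e(R),e(B)\}>{\rm bal}_r(n,G)$). -}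

module Defs where

open import Data.Bool.Base using (Bool; false; not; _∧_; T)
open import Data.Bool.Properties using (T?; ∧-comm; T-∧)
open import Data.Fin.Base using (Fin; _<_)
open import Data.Fin.Properties using (_≟_; _<?_)
open import Data.Fin.Subset using (Subset; _∈_; _∪_; _∩_; ⊤; ⊥)
open import Data.Fin.Subset.Properties using (_∈?_)
open import Data.List.Base using (List; length; filter; allFin; cartesianProduct)
open import Data.Nat.Base as ℕ using (ℕ; _∸_; _⊓_; ⌊_/2⌋)
open import Data.Nat.Combinatorics using (_C_)
open import Data.Product.Base using (Σ-syntax; ∃-syntax; _×_; _,_; proj₁; proj₂)
open import Data.Sum.Base using (_⊎_)
open import Function.Bundles using (Equivalence)
open import Function.Definitions using (Injective)
open import Relation.Binary.PropositionalEquality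
  using (_≡_; refl; sym; cong; cong₂)
open import Relation.Nullary.Decidable
  using (Dec; does; yes; no; _×-dec_; _⊎-dec_; dec-true)
open import Relation.Nullary.Negation using (contradiction)

record Graph (n : ℕ) : Set where
  field
    adj       : Fin n → Fin n → Bool
    adj-sym   : ∀ x y → adj x y ≡ adj y x
    adj-irref : ∀ x → adj x x ≡ false

open Graph public

-- Each edge is listed once, with its smaller end first.
edges : ∀ {n} → Graph n → List (Fin n × Fin n)
edges {n} G =
  filter (λ (x , y) → (x <? y) ×-dec T? (adj G x y))
         (cartesianProduct (allFin n) (allFin n))

e : ∀ {n} → Graph n → ℕ
e G = length (edges G)

distinct : ∀ {n} → Fin n → Fin n → Bool
distinct x y = not (does (x ≟ y))

distinct-sym : ∀ {n} (x y : Fin n) → distinct x y ≡ distinct y x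
distinct-sym x y with x ≟ y | y ≟ x
... | yes _   | yes _   = refl
... | no _    | no _    = refl
... | yes x≡y | no y≢x  = contradiction (sym x≡y) y≢x
... | no x≢y  | yes y≡x = contradiction (sym y≡x) x≢y

distinct-irrefl : ∀ {n} (x : Fin n) → distinct x x ≡ false
distinct-irrefl x = cong not (dec-true (x ≟ x) refl)

complete : ∀ n → Graph n
complete n = record
  { adj       = distinct
  ; adj-sym   = distinct-sym
  ; adj-irref = distinct-irrefl
  }

complement : ∀ {n} → Graph n → Graph n
complement G = record
  { adj       = λ x y → distinct x y ∧ not (adj G x y)
  ; adj-sym   = λ x y → cong₂ _∧_ (distinct-sym x y) (cong not (adj-sym G x y))
  ; adj-irref = λ x → cong (_∧ not (adj G x x)) (distinct-irrefl x)
  }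

-- The edge set is carried by a graph on all of Fin n, which is required to
-- have no edges meeting the outside of the vertex set.
record Subgraph {n : ℕ} (G : Graph n) : Set where
  field
    vertices : Subset n
    graph    : Graph n
    ends     : ∀ {x y} → T (adj graph x y) → x ∈ vertices × y ∈ vertices
    adj⊆     : ∀ {x y} → T (adj graph x y) → T (adj G x y)

open Subgraph public

induced : ∀ {n} (G : Graph n) → Subset n → Subgraph G
induced G W = record
  { vertices = W
  ; graph    = record
    { adj       = λ x y → adj G x y ∧ inside x y
    ; adj-sym   = λ x y → cong₂ _∧_ (adj-sym G x y)
                    (∧-comm (does (x ∈? W)) (does (y ∈? W)))
    ; adj-irref = λ x → cong (_∧ inside x x) (adj-irref G x)
    }
  ; ends     = λ {x} {y} t →
      witness ((x ∈? W) ×-dec (y ∈? W)) (proj₂ (split x y t))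
  ; adj⊆     = λ {x} {y} t → proj₁ (split x y t)
  }
  where
  inside : Fin _ → Fin _ → Bool
  inside x y = does (x ∈? W) ∧ does (y ∈? W)

  split : ∀ x y → T (adj G x y ∧ inside x y) → T (adj G x y) × T (inside x y)
  split x y = Equivalence.to T-∧

  witness : ∀ {A : Set} (d : Dec A) → T (does d) → A
  witness (yes a) _ = a

record _≅_ {k n : ℕ} {K : Graph n} (G : Graph k) (S : Subgraph K) : Set where
  field
    map        : Fin k → Fin n
    injective  : Injective _≡_ _≡_ map
    into       : ∀ u → map u ∈ vertices S
    onto       : ∀ {x} → x ∈ vertices S → ∃[ u ] map u ≡ x
    adj-resp   : ∀ u v → adj (graph S) (map u) (map v) ≡ adj G u v

-- A 2-coloring of E(Kₙ) is determined by its red graph.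
record Coloring (n : ℕ) : Set where
  field
    red : Graph n

  blue : Graph n
  blue = complement red

open Coloring public

-- The number of edges of H that are also edges of F.
common : ∀ {n} → Graph n → Graph n → ℕ
common H F = length (filter (λ (x , y) → T? (adj F x y)) (edges H))

HasColoredCopy : ∀ {k n} → Graph k → ℕ → ℕ → Coloring n → Set
HasColoredCopy {n = n} G r b c =
  Σ[ S ∈ Subgraph (complete n) ]
    G ≅ S × common (graph S) (red c) ≡ r × common (graph S) (blue c) ≡ b

Forces : ∀ {k} → Graph k → ℕ → ℕ → ℕ → Set
Forces G r n s = (c : Coloring n) → e (red c) ⊓ e (blue c) ℕ.> s →
  HasColoredCopy G r (e G ∸ r) c ⊎ HasColoredCopy G (e G ∸ r) r c

-- IsBal G r n s says bal_r(n,G) = s.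
IsBal : ∀ {k} → Graph k → ℕ → ℕ → ℕ → Set
IsBal G r n s = Forces G r n s × (∀ s′ → Forces G r n s′ → s ℕ.≤ s′)

Tonal : ∀ {k} → ℕ → Graph k → Set
Tonal r G = ∃[ N ] ∀ n → n ℕ.≥ N →
  ∃[ s ] IsBal G r n s × s ℕ.< ⌊ n C 2 /2⌋

IsPartition : ∀ {n} → Subset n → Subset n → Set
IsPartition X Y = X ∪ Y ≡ ⊤ × X ∩ Y ≡ ⊥

eBetween : ∀ {n} → Graph n → Subset n → Subset n → ℕ
eBetween G X Y = length (filter
  (λ (x , y) → ((x ∈? X) ×-dec (y ∈? Y)) ⊎-dec ((x ∈? Y) ×-dec (y ∈? X)))
  (edges G))

{-# OPTIONS --safe #-}

-- Exactly half of the edges of K_n can form a complete bipartite graph (whenever n is a square)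
-- and can form a clique (whenever n solves a Pell equation), so for arbitrarily large n both
-- colorings must contain the required copy of G; pulling back the bipartition and the clique
-- along the copy gives X, Y and W.
--
-- Conversely, let n be large and the coloring balanced, and take a large monochromatic clique L,
-- say red. The blue graph is dense, so it contains a large complete bipartite graph with parts
-- P and Q. By Ramsey, either P and Q both contain large red cliques, which have only blue edges
-- between them, and X and Y are mapped into one each; or there is a large blue clique, and
-- making the edges between it and L monochromatic leaves a clique of one colour all of whose
-- surroundings have the other, into which W is mapped.
--
-- Edge numbers are compared after doubling, as sums over all ordered pairs of vertices: unlike
-- lists of edges with increasing ends, these sums are compatible with arbitrary injections.

module Submission where

open import Data.Bool.Base using (Bool; true; false; T; not; _∧_; _∨_; _xor_)
import Data.Bool.Properties as Bool
open import Data.Fin.Base as Fin using (Fin; zero; suc; toℕ; inject≤; punchIn; punchOut; combine; remQuot; finToFun; funToFin)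
import Data.Fin.Properties as Fin
open import Data.Fin.Subset using (Subset; _∈_; ∁)
open import Data.Fin.Subset.Properties
  using (_∈?_; anySubset?; p∪∁p≡⊤; ∩-inverseʳ; x∈p∪q⁻; x∈p∩q⁺; ∈⊤; ∉⊥)
open import Data.List.Base
  using (List; []; _∷_; _++_; length; map; filter; take; lookup; tabulate; allFin; cartesianProduct)
import Data.List.Membership.DecPropositional as DecMembership
import Data.List.Membership.Propositional as List
import Data.List.Membership.Propositional.Properties as List
open import Data.List.Properties
  using (length-map; length-take; length-tabulate; length-++; map-tabulate; filter-++; filter-accept; filter-reject; filter-all)
open import Data.List.Relation.Binary.Sublist.Propositional
  using (_⊆_; []; _∷_; _∷ʳ_; ⊆-refl; ⊆-trans; minimum)
open import Data.List.Relation.Binary.Sublist.Propositional.Properties as Sublist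
  using (All-resp-⊆; filter-⊆; take-⊆)
open import Data.List.Relation.Unary.All as All using (All; []; _∷_)
import Data.List.Relation.Unary.All.Properties as All
open import Data.List.Relation.Unary.AllPairs as AllPairs using (AllPairs; []; _∷_)
import Data.List.Relation.Unary.AllPairs.Properties as AllPairs
open import Data.List.Relation.Unary.Any using (index)
open import Data.List.Relation.Unary.Any.Properties using (lookup-index)
open import Data.List.Relation.Unary.Unique.Propositional using (Unique)
open import Data.List.Relation.Unary.Unique.Propositional.Properties using (allFin⁺)
open import Data.Nat
open import Data.Nat.Combinatorics using (_C_; nC1≡n; nCk+nC[k+1]≡[n+1]C[k+1])
open import Data.Nat.ListAction using (sum)
open import Data.Nat.Properties
open import Data.Nat.Tactic.RingSolver using (solve-∀)
open import Data.Product.Base using (Σ-syntax; ∃-syntax; _×_; _,_; proj₁; proj₂; uncurry)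
open import Data.Sum.Base as Sum using (_⊎_; inj₁; inj₂)
import Data.Vec.Base as Vec
import Data.Vec.Properties as Vec
open import Function.Base using (_∘_; _on_; id)
open import Function.Bundles using (_⇔_; mk⇔; Equivalence)
open import Function.Definitions using (Injective)
open import Level using (Level)
open import Relation.Binary.Core using (Rel)
open import Relation.Binary.Definitions using (Symmetric; tri<; tri≈; tri>)
open import Relation.Binary.PropositionalEquality
open import Relation.Nullary.Decidable hiding (map)
open import Relation.Nullary.Negation using (¬_; contradiction)
open import Relation.Unary using (Decidable)
open import Defs

open import Algebra.Properties.Semiring.Sum +-*-semiring
  using (sum-syntax; sum-cong-≗; sum-replicate-zero; sum-remove; ∑-distrib-+; ∑-comm; *-distribˡ-sum; *-distribʳ-sum)

private variable
  α ℓ ℓ′ : Level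
  A B : Set α

-- Ramsey and Kővári–Sós–Turán

⟦_⟧ : Bool → ℕ
⟦ true ⟧  = 1
⟦ false ⟧ = 0

AllPairs-resp-⊆ : {R : Rel A ℓ} {xs ys : List A} → xs ⊆ ys → AllPairs R ys → AllPairs R xs
AllPairs-resp-⊆ []         []       = []
AllPairs-resp-⊆ (_ ∷ʳ s)   (_ ∷ ps) = AllPairs-resp-⊆ s ps
AllPairs-resp-⊆ (refl ∷ s) (p ∷ ps) = All-resp-⊆ s p ∷ AllPairs-resp-⊆ s ps

length-filter-Bool : (p : A → Bool) (xs : List A) →
  length (filter (λ x → p x Bool.≟ true) xs) + length (filter (λ x → p x Bool.≟ false) xs) ≡ length xs
length-filter-Bool p []       = refl
length-filter-Bool p (x ∷ xs) with p x
... | true  = cong suc (length-filter-Bool p xs)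
... | false = trans (+-suc _ _) (cong suc (length-filter-Bool p xs))

double≤+⇒≤⊎≤ : ∀ m {i j} → 2 * m ≤ i + j → m ≤ i ⊎ m ≤ j
double≤+⇒≤⊎≤ m {i} {j} 2m≤i+j with m ≤? i
... | yes m≤i = inj₁ m≤i
... | no  m≰i = inj₂ (+-cancelˡ-≤ m m j (begin
  m + m  ≡⟨ cong (m +_) (+-identityʳ m) ⟨
  2 * m  ≤⟨ 2m≤i+j ⟩
  i + j  ≤⟨ +-monoˡ-≤ j (<⇒≤ (≰⇒> m≰i)) ⟩
  m + j  ∎))
  where open ≤-Reasoning

halve : (p : A → Bool) (xs : List A) (m : ℕ) → 2 * m ≤ length xs →
  ∃[ b ] ∃[ ys ] ys ⊆ xs × All (λ y → p y ≡ b) ys × m ≤ length ys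
halve p xs m 2m≤ with double≤+⇒≤⊎≤ m (≤-trans 2m≤ (≤-reflexive (sym (length-filter-Bool p xs))))
... | inj₁ m≤ = true  , _ , filter-⊆ _ xs , All.all-filter _ xs , m≤
... | inj₂ m≤ = false , _ , filter-⊆ _ xs , All.all-filter _ xs , m≤

-- This is 2^m - 1: each step uses up one vertex and keeps at least half of the others.
ramseyBound : ℕ → ℕ
ramseyBound zero    = 0
ramseyBound (suc m) = suc (2 * ramseyBound m)

-- Each vertex of the sequence carries the common colour of its edges to the later vertices.
prehomogeneous : (col : A → A → Bool) (m : ℕ) (xs : List A) → ramseyBound m ≤ length xs →
  ∃[ ps ] map proj₁ ps ⊆ xs × length ps ≡ m × AllPairs (λ (x , b) (y , _) → col x y ≡ b) ps
prehomogeneous col zero    xs       _        = [] , minimum xs , refl , []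
prehomogeneous col (suc m) (x ∷ xs) (s≤s m≤) =
  let b , ys , ys⊆ , x-ys , m≤ys = halve (col x) xs (ramseyBound m) m≤
      ps , ps⊆ , len , homog     = prehomogeneous col m ys m≤ys
  in (x , b) ∷ ps , refl ∷ ⊆-trans ps⊆ ys⊆ , cong suc len , All.map⁻ (All-resp-⊆ ps⊆ x-ys) ∷ homog

-- Of the 2t labels of a prehomogeneous sequence at least t agree. The edge between two vertices has
-- the label of the earlier one as its colour, so vertices with the same label form a monochromatic
-- clique.
ramsey : (col : A → A → Bool) (t : ℕ) (xs : List A) → ramseyBound (2 * t) ≤ length xs →
  ∃[ b ] ∃[ ys ] ys ⊆ xs × t ≤ length ys × AllPairs (λ x y → col x y ≡ b) ys
ramsey col t xs bound =
  let ps , ps⊆ , len , homog   = prehomogeneous col (2 * t) xs bound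
      b , qs , qs⊆ , same , t≤ = halve proj₂ ps t (≤-reflexive (sym len))
  in b , map proj₁ qs , ⊆-trans (Sublist.map⁺ proj₁ qs⊆) ps⊆
   , ≤-trans t≤ (≤-reflexive (sym (length-map proj₁ qs)))
   , AllPairs.map⁺ (restrict same (AllPairs-resp-⊆ qs⊆ homog))
  where
  restrict : ∀ {b qs} → All (λ q → proj₂ q ≡ b) qs → AllPairs (λ (x , c) (y , _) → col x y ≡ c) qs →
    AllPairs ((λ x y → col x y ≡ b) on proj₁) qs
  restrict []         []       = []
  restrict (refl ∷ s) (h ∷ hs) = h ∷ restrict s hs

degree : (A → A → Bool) → List A → A → ℕ
degree E vs x = sum (map (λ v → ⟦ E v x ⟧) vs)

Complete : (A → A → Bool) → List A → List A → Set _
Complete E vs xs = All (λ v → All (λ x → E v x ≡ true) xs) vs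

-- Halving the right side according to adjacency to each left vertex in turn, the neighbours of
-- that vertex are either kept (and it joins the biclique) or avoided (and no degree drops).
biclique : (E : A → A → Bool) (p t : ℕ) (vs xs : List A) → All (λ x → p ≤ degree E vs x) xs →
  2 ^ length vs * suc t ≤ length xs →
  ∃[ us ] ∃[ ys ] us ⊆ vs × ys ⊆ xs × p ≤ length us × t ≤ length ys × Complete E us ys
biclique E zero    t vs       xs       deg    len =
  [] , xs , minimum vs , ⊆-refl , z≤n ,
  ≤-trans (≤-trans (n≤1+n t) (m≤n*m (suc t) (2 ^ length vs) {{m^n≢0 2 (length vs)}})) len , []
-- No left vertex remains, so every degree is 0, which is less than `suc p`. The factor `suc t` in
-- the length bound, rather than `t`, ensures that there is an `x` to witness this even when `t` is
-- 0.
biclique E (suc p) t []       (x ∷ xs) (() ∷ _) len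
biclique E (suc p) t (v ∷ vs) xs       deg    len
  with halve (E v) xs (2 ^ length vs * suc t) (≤-trans (≤-reflexive (sym (*-assoc 2 (2 ^ length vs) (suc t)))) len)
... | true , ys , ys⊆ , adj , len′ =
  let us , zs , us⊆ , zs⊆ , p≤ , t≤ , full = biclique E p t vs ys (decrease (All.zip (adj , All-resp-⊆ ys⊆ deg))) len′
  in v ∷ us , zs , refl ∷ us⊆ , ⊆-trans zs⊆ ys⊆ , s≤s p≤ , t≤ , All-resp-⊆ zs⊆ adj ∷ full
  where
  decrease : ∀ {ys} → All (λ y → E v y ≡ true × suc p ≤ degree E (v ∷ vs) y) ys → All (λ y → p ≤ degree E vs y) ys
  decrease = All.map λ {y} (e , d) → s≤s⁻¹ (subst (λ b → suc p ≤ ⟦ b ⟧ + degree E vs y) e d)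
... | false , ys , ys⊆ , adj , len′ =
  let us , zs , us⊆ , zs⊆ , p≤ , t≤ , full = biclique E (suc p) t vs ys (keep (All.zip (adj , All-resp-⊆ ys⊆ deg))) len′
  in us , zs , v ∷ʳ us⊆ , ⊆-trans zs⊆ ys⊆ , p≤ , t≤ , full
  where
  keep : ∀ {ys} → All (λ y → E v y ≡ false × suc p ≤ degree E (v ∷ vs) y) ys → All (λ y → suc p ≤ degree E vs y) ys
  keep = All.map λ {y} (e , d) → subst (λ b → suc p ≤ ⟦ b ⟧ + degree E vs y) e d

sum-map-≤ : {f g : A → ℕ} (xs : List A) → All (λ x → f x ≤ g x) xs → sum (map f xs) ≤ sum (map g xs)
sum-map-≤ []       []       = z≤n
sum-map-≤ (x ∷ xs) (p ∷ ps) = +-mono-≤ p (sum-map-≤ xs ps)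

sum-map-+ : (f g : A → ℕ) (xs : List A) → sum (map (λ x → f x + g x) xs) ≡ sum (map f xs) + sum (map g xs)
sum-map-+ f g []       = refl
sum-map-+ f g (x ∷ xs) = trans (cong (f x + g x +_) (sum-map-+ f g xs)) (lemma (f x) (g x) (sum (map f xs)) _)
  where
  lemma : ∀ a b c d → a + b + (c + d) ≡ a + c + (b + d)
  lemma = solve-∀

sum-map-const : (c : ℕ) (xs : List A) → sum (map (λ _ → c) xs) ≡ length xs * c
sum-map-const c []       = refl
sum-map-const c (x ∷ xs) = cong (c +_) (sum-map-const c xs)

sum-map-*ˡ : (c : ℕ) (f : A → ℕ) (xs : List A) → sum (map (λ x → c * f x) xs) ≡ c * sum (map f xs)
sum-map-*ˡ c f []       = sym (*-zeroʳ c)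
sum-map-*ˡ c f (x ∷ xs) = trans (cong (c * f x +_) (sum-map-*ˡ c f xs)) (sym (*-distribˡ-+ c (f x) _))

sum-⟦⟧≤length : (p : A → Bool) (xs : List A) → sum (map (λ x → ⟦ p x ⟧) xs) ≤ length xs
sum-⟦⟧≤length p [] = z≤n
sum-⟦⟧≤length p (x ∷ xs) with p x
... | true  = s≤s (sum-⟦⟧≤length p xs)
... | false = m≤n⇒m≤1+n (sum-⟦⟧≤length p xs)

-- Double counting of the pairs that `E` relates, by their right end and by their left end.
sum-degree : (E : A → A → Bool) (vs xs : List A) →
  sum (map (degree E vs) xs) ≡ sum (map (λ v → sum (map (λ x → ⟦ E v x ⟧) xs)) vs)
sum-degree E []       xs = trans (sum-map-const 0 xs) (*-zeroʳ (length xs))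
sum-degree E (v ∷ vs) xs =
  trans (sum-map-+ (λ x → ⟦ E v x ⟧) (degree E vs) xs) (cong (sum (map (λ x → ⟦ E v x ⟧) xs) +_) (sum-degree E vs xs))

-- Entries that reach `τ` contribute at most `b` each, the others less than `τ`. Charging `τ` to
-- every entry, the heavy ones included, avoids subtraction.
markov : (f : A → ℕ) (τ b : ℕ) (xs : List A) → (∀ x → f x ≤ b) →
  sum (map f xs) ≤ length (filter (λ x → τ ≤? f x) xs) * b + length xs * τ
markov f τ b []       f≤b = z≤n
markov f τ b (x ∷ xs) f≤b = step (τ ≤? f x)
  where
  open ≤-Reasoning
  heavy : List _ → List _
  heavy = filter (λ x → τ ≤? f x)
  h = length (heavy xs)

  swap : ∀ a b c → a + (b + c) ≡ b + (a + c)
  swap = solve-∀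

  step : Dec (τ ≤ f x) → f x + sum (map f xs) ≤ length (heavy (x ∷ xs)) * b + suc (length xs) * τ
  step (yes τ≤) = begin
    f x + sum (map f xs)                           ≤⟨ +-mono-≤ (f≤b x) (markov f τ b xs f≤b) ⟩
    b + (h * b + length xs * τ)                    ≡⟨ +-assoc b (h * b) _ ⟨
    suc h * b + length xs * τ                      ≤⟨ +-monoʳ-≤ (suc h * b) (m≤n+m _ τ) ⟩
    suc h * b + suc (length xs) * τ                ≡⟨ cong (λ l → length l * b + suc (length xs) * τ) (filter-accept (λ x → τ ≤? f x) τ≤) ⟨
    length (heavy (x ∷ xs)) * b + suc (length xs) * τ ∎
  step (no τ≰) = begin
    f x + sum (map f xs)                           ≤⟨ +-mono-≤ (<⇒≤ (≰⇒> τ≰)) (markov f τ b xs f≤b) ⟩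
    τ + (h * b + length xs * τ)                    ≡⟨ swap τ (h * b) (length xs * τ) ⟩
    h * b + suc (length xs) * τ                    ≡⟨ cong (λ l → length l * b + suc (length xs) * τ) (filter-reject (λ x → τ ≤? f x) τ≰) ⟨
    length (heavy (x ∷ xs)) * b + suc (length xs) * τ ∎

-- The left side consists of 32p vertices of degree at least n/16; then at least n/32 vertices
-- have p neighbours among them, which leaves room for `biclique`.
kstBound : ℕ → ℕ → ℕ
kstBound p t = 32 * (2 ^ (32 * p) * suc t) + 16 * (32 * p)

kővári-sós-turán : (E : A → A → Bool) (p t : ℕ) (xs : List A) → kstBound (suc p) t ≤ length xs →
  length xs * length xs ≤ 8 * sum (map (degree E xs) xs) →
  ∃[ us ] ∃[ ys ] us ⊆ xs × ys ⊆ xs × suc p ≤ length us × t ≤ length ys × Complete E us ys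
kővári-sós-turán {A = A} E p t xs large dense =
  let us , ys , us⊆ , ys⊆ , p≤ , t≤ , full = biclique E q t vs good (All.all-filter _ xs) good-large
  in us , ys , ⊆-trans us⊆ (⊆-trans (take-⊆ M heavy) (filter-⊆ _ xs))
   , ⊆-trans ys⊆ (filter-⊆ _ xs) , p≤ , t≤ , full
  where
  open ≤-Reasoning
  n q M : ℕ
  n = length xs
  q = suc p
  M = 32 * q

  deg : A → ℕ
  deg v = sum (map (λ x → ⟦ E v x ⟧) xs)

  heavy vs good : List A
  heavy = filter (λ v → n ≤? 16 * deg v) xs
  vs    = take M heavy
  good  = filter (λ x → q ≤? degree E vs x) xs

  instance
    n≢0 : NonZero n
    n≢0 = >-nonZero (≤-trans (s≤s z≤n) (≤-trans (m≤n+m (16 * M) (32 * (2 ^ M * suc t))) large))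

  -- By density the numbers 16 · `deg v` sum to at least 2n². Vertices below the threshold n account
  -- for at most n², and each heavy vertex for at most 16n, so there are at least n/16 heavy
  -- vertices.
  heavy-large : M ≤ length heavy
  heavy-large = *-cancelˡ-≤ 16 (≤-trans (m+n≤o⇒n≤o (32 * (2 ^ M * suc t)) large)
    (*-cancelʳ-≤ n (16 * length heavy) n (+-cancelʳ-≤ (n * n) (n * n) _ (begin
    n * n + n * n                    ≡⟨ double (n * n) ⟩
    2 * (n * n)                      ≤⟨ *-monoʳ-≤ 2 dense ⟩
    2 * (8 * sum (map (degree E xs) xs)) ≡⟨ *-assoc 2 8 (sum (map (degree E xs) xs)) ⟨
    16 * sum (map (degree E xs) xs)  ≡⟨ cong (16 *_) (sum-degree E xs xs) ⟩
    16 * sum (map deg xs)            ≡⟨ sum-map-*ˡ 16 deg xs ⟨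
    sum (map (λ v → 16 * deg v) xs)  ≤⟨ markov (λ v → 16 * deg v) n (16 * n) xs
                                          (λ v → *-monoʳ-≤ 16 (sum-⟦⟧≤length (E v) xs)) ⟩
    length heavy * (16 * n) + n * n  ≡⟨ cong (_+ n * n) (swap (length heavy) n) ⟩
    16 * length heavy * n + n * n    ∎))))
    where
    double : ∀ a → a + a ≡ 2 * a
    double = solve-∀
    swap : ∀ h n → h * (16 * n) ≡ 16 * h * n
    swap = solve-∀

  length-vs : length vs ≡ M
  length-vs = trans (length-take M heavy) (m≤n⇒m⊓n≡m heavy-large)

  -- The vertices of `vs` have at least Mn/16 = 2qn neighbours in total, counted with multiplicity.
  -- Vertices with fewer than q neighbours in `vs` receive at most qn of these, so the good ones
  -- receive at least qn, and each of them at most M = 32q.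
  good-count : n ≤ 32 * length good
  good-count = *-cancelˡ-≤ (16 * q) (+-cancelʳ-≤ (16 * q * n) _ _ (begin
    16 * q * n + 16 * q * n                 ≡⟨ split q n ⟩
    M * n                                   ≡⟨ cong (_* n) length-vs ⟨
    length vs * n                           ≡⟨ sum-map-const n vs ⟨
    sum (map (λ _ → n) vs)                  ≤⟨ sum-map-≤ vs (All-resp-⊆ (take-⊆ M heavy) (All.all-filter _ xs)) ⟩
    sum (map (λ v → 16 * deg v) vs)         ≡⟨ sum-map-*ˡ 16 deg vs ⟩
    16 * sum (map deg vs)                   ≡⟨ cong (16 *_) (sum-degree E vs xs) ⟨
    16 * sum (map (degree E vs) xs)         ≤⟨ *-monoʳ-≤ 16 (markov (degree E vs) q M xs
                                                 (λ x → ≤-trans (sum-⟦⟧≤length (λ v → E v x) vs) (≤-reflexive length-vs))) ⟩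
    16 * (length good * M + n * q)          ≡⟨ regroup (length good) q n ⟩
    16 * q * (32 * length good) + 16 * q * n ∎))
    where
    split : ∀ q n → 16 * q * n + 16 * q * n ≡ 32 * q * n
    split = solve-∀
    regroup : ∀ g q n → 16 * (g * (32 * q) + n * q) ≡ 16 * q * (32 * g) + 16 * q * n
    regroup = solve-∀

  good-large : 2 ^ length vs * suc t ≤ length good
  good-large = subst (λ l → 2 ^ l * suc t ≤ length good) (sym length-vs)
    (*-cancelˡ-≤ 32 (≤-trans (m+n≤o⇒m≤o _ large) good-count))

-- Counting ordered pairs

∑∑ : ∀ {m n} → (Fin m → Fin n → Bool) → ℕ
∑∑ {m} {n} b = ∑[ x < m ] ∑[ y < n ] ⟦ b x y ⟧

∑∑-cong : ∀ {m n} {b c : Fin m → Fin n → Bool} → (∀ x y → b x y ≡ c x y) → ∑∑ b ≡ ∑∑ c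
∑∑-cong b≗c = sum-cong-≗ λ x → sum-cong-≗ λ y → cong ⟦_⟧ (b≗c x y)

∑∑-+ : ∀ {m n} {b c d : Fin m → Fin n → Bool} → (∀ x y → ⟦ b x y ⟧ + ⟦ c x y ⟧ ≡ ⟦ d x y ⟧) → ∑∑ b + ∑∑ c ≡ ∑∑ d
∑∑-+ {m} {n} {b} {c} b+c≗d = trans
  (sym (∑-distrib-+ (λ x → ∑[ y < n ] ⟦ b x y ⟧) (λ x → ∑[ y < n ] ⟦ c x y ⟧)))
  (sum-cong-≗ λ x → trans (sym (∑-distrib-+ (λ y → ⟦ b x y ⟧) (λ y → ⟦ c x y ⟧))) (sum-cong-≗ (b+c≗d x)))

length-filter-tabulate : {P : A → Set ℓ} (P? : Decidable P) {n : ℕ} (f : Fin n → A) →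
  length (filter P? (tabulate f)) ≡ ∑[ i < n ] ⟦ does (P? (f i)) ⟧
length-filter-tabulate P? {zero}  f = refl
length-filter-tabulate P? {suc n} f with does (P? (f zero))
... | true  = cong suc (length-filter-tabulate P? (f ∘ suc))
... | false = length-filter-tabulate P? (f ∘ suc)

length-filter-product : {P : A × B → Set ℓ} (P? : Decidable P) {m n : ℕ} (f : Fin m → A) (g : Fin n → B) →
  length (filter P? (cartesianProduct (tabulate f) (tabulate g))) ≡ ∑∑ (λ x y → does (P? (f x , g y)))
length-filter-product P? {zero}  f g = refl
length-filter-product P? {suc m} f g = begin
  length (filter P? (map (f zero ,_) (tabulate g) ++ rest))
    ≡⟨ cong length (filter-++ P? (map (f zero ,_) (tabulate g)) rest) ⟩
  length (filter P? (map (f zero ,_) (tabulate g)) ++ filter P? rest)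
    ≡⟨ length-++ (filter P? (map (f zero ,_) (tabulate g))) ⟩
  length (filter P? (map (f zero ,_) (tabulate g))) + length (filter P? rest)
    ≡⟨ cong₂ _+_
         (trans (cong (length ∘ filter P?) (map-tabulate g (f zero ,_))) (length-filter-tabulate P? (λ y → f zero , g y)))
         (length-filter-product P? (f ∘ suc) g) ⟩
  ∑∑ (λ x y → does (P? (f x , g y))) ∎
  where
  open ≡-Reasoning
  rest = cartesianProduct (tabulate (f ∘ suc)) (tabulate g)

length-filter-filter : {P : A → Set ℓ} {Q : A → Set ℓ′} (P? : Decidable P) (Q? : Decidable Q) (xs : List A) →
  length (filter Q? (filter P? xs)) ≡ length (filter (λ x → P? x ×-dec Q? x) xs)
length-filter-filter P? Q? []       = refl
length-filter-filter P? Q? (x ∷ xs) with does (P? x)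
... | false = length-filter-filter P? Q? xs
... | true with does (Q? x)
...   | true  = cong suc (length-filter-filter P? Q? xs)
...   | false = length-filter-filter P? Q? xs

-- Reflection in the diagonal exchanges the pairs with x < y and those with y < x, and the diagonal
-- itself contributes nothing.
∑∑-<-double : ∀ {n} (b : Fin n → Fin n → Bool) → (∀ x y → b x y ≡ b y x) → (∀ x → b x x ≡ false) →
  2 * ∑∑ (λ x y → does (x Fin.<? y) ∧ b x y) ≡ ∑∑ b
∑∑-<-double {n} b b-sym b-irrefl = begin
  2 * ∑∑ lt            ≡⟨ cong (∑∑ lt +_) (+-identityʳ (∑∑ lt)) ⟩
  ∑∑ lt + ∑∑ lt        ≡⟨ cong (∑∑ lt +_) (∑-comm (λ x y → ⟦ lt x y ⟧)) ⟩
  ∑∑ lt + ∑∑ (λ x y → lt y x) ≡⟨ ∑∑-+ one ⟩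
  ∑∑ b                 ∎
  where
  open ≡-Reasoning
  lt : Fin n → Fin n → Bool
  lt x y = does (x Fin.<? y) ∧ b x y

  one : ∀ x y → ⟦ lt x y ⟧ + ⟦ lt y x ⟧ ≡ ⟦ b x y ⟧
  one x y with Fin.<-cmp x y
  ... | tri< x<y _ y≮x rewrite dec-true (x Fin.<? y) x<y | dec-false (y Fin.<? x) y≮x = +-identityʳ _
  ... | tri≈ x≮x refl _ rewrite dec-false (x Fin.<? x) x≮x | b-irrefl x = refl
  ... | tri> x≮y _ y<x rewrite dec-false (x Fin.<? y) x≮y | dec-true (y Fin.<? x) y<x = cong ⟦_⟧ (b-sym y x)

2*e≡∑∑ : ∀ {n} (G : Graph n) → 2 * e G ≡ ∑∑ (adj G)
2*e≡∑∑ G = trans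
  (cong (2 *_) (length-filter-product (λ (x , y) → (x Fin.<? y) ×-dec T? (adj G x y)) id id))
  (∑∑-<-double (adj G) (adj-sym G) (adj-irref G))

2*filter-edges≡∑∑ : ∀ {n} (G : Graph n) {P : Fin n × Fin n → Set} (P? : Decidable P) →
  (∀ x y → does (P? (x , y)) ≡ does (P? (y , x))) →
  2 * length (filter P? (edges G)) ≡ ∑∑ (λ x y → adj G x y ∧ does (P? (x , y)))
2*filter-edges≡∑∑ {n} G P? P-sym = begin
  2 * length (filter P? (edges G))
    ≡⟨ cong (2 *_) (length-filter-filter edge? P? (cartesianProduct (allFin n) (allFin n))) ⟩
  2 * length (filter (λ z → edge? z ×-dec P? z) (cartesianProduct (allFin n) (allFin n)))
    ≡⟨ cong (2 *_) (length-filter-product (λ z → edge? z ×-dec P? z) id id) ⟩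
  2 * ∑∑ (λ x y → (does (x Fin.<? y) ∧ adj G x y) ∧ does (P? (x , y)))
    ≡⟨ cong (2 *_) (∑∑-cong λ x y → Bool.∧-assoc (does (x Fin.<? y)) (adj G x y) (does (P? (x , y)))) ⟩
  2 * ∑∑ (λ x y → does (x Fin.<? y) ∧ (adj G x y ∧ does (P? (x , y))))
    ≡⟨ ∑∑-<-double (λ x y → adj G x y ∧ does (P? (x , y)))
         (λ x y → cong₂ _∧_ (adj-sym G x y) (P-sym x y)) (λ x → cong (_∧ _) (adj-irref G x)) ⟩
  ∑∑ (λ x y → adj G x y ∧ does (P? (x , y))) ∎
  where
  open ≡-Reasoning
  edge? : Decidable (λ (x , y) → x Fin.< y × T (adj G x y))
  edge? (x , y) = (x Fin.<? y) ×-dec T? (adj G x y)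

2*common≡∑∑ : ∀ {n} (G F : Graph n) → 2 * common G F ≡ ∑∑ (λ x y → adj G x y ∧ adj F x y)
2*common≡∑∑ G F = 2*filter-edges≡∑∑ G (λ (x , y) → T? (adj F x y)) (adj-sym F)

2*eBetween≡∑∑ : ∀ {n} (G : Graph n) (X Y : Subset n) → 2 * eBetween G X Y ≡
  ∑∑ (λ x y → adj G x y ∧ (does (x ∈? X) ∧ does (y ∈? Y) ∨ does (x ∈? Y) ∧ does (y ∈? X)))
2*eBetween≡∑∑ G X Y = 2*filter-edges≡∑∑ G _ λ x y → trans
  (Bool.∨-comm (does (x ∈? X) ∧ does (y ∈? Y)) (does (x ∈? Y) ∧ does (y ∈? X)))
  (cong₂ _∨_ (Bool.∧-comm (does (x ∈? Y)) (does (y ∈? X))) (Bool.∧-comm (does (x ∈? X)) (does (y ∈? Y))))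

-- Induction on `k`: the term at `f zero` is split off, and the rest of `f`, which misses that
-- point, becomes an injection into a set with one element fewer through `punchOut`.
∑-image : ∀ {k n} {f : Fin k → Fin n} → Injective _≡_ _≡_ f → (g : Fin n → ℕ) →
  (∀ x → (∀ u → f u ≢ x) → g x ≡ 0) → ∑[ x < n ] g x ≡ ∑[ u < k ] g (f u)
∑-image {zero}  {n}     inj g g≡0 = trans (sum-cong-≗ (λ x → g≡0 x (λ ()))) (sum-replicate-zero n)
∑-image {suc k} {zero}  {f} inj g g≡0 with () ← f zero
∑-image {suc k} {suc n} {f} inj g g≡0 = trans (sum-remove {i = f zero} g)
  (cong (g (f zero) +_) (trans (∑-image f′-injective (g ∘ punchIn (f zero)) vanish)
    (sum-cong-≗ λ u → cong g (Fin.punchIn-punchOut (f0≢ u)))))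
  where
  f0≢ : ∀ u → f zero ≢ f (suc u)
  f0≢ u eq with () ← inj eq

  f′ : Fin k → Fin n
  f′ u = punchOut (f0≢ u)

  f′-injective : Injective _≡_ _≡_ f′
  f′-injective {u} {v} eq = Fin.suc-injective (inj (Fin.punchOut-injective (f0≢ u) (f0≢ v) eq))

  vanish : ∀ x → (∀ u → f′ u ≢ x) → g (punchIn (f zero) x) ≡ 0
  vanish x f′≢x = g≡0 _ λ where
    zero    eq → Fin.punchInᵢ≢i (f zero) x (sym eq)
    (suc u) eq → f′≢x u (Fin.punchIn-injective (f zero) _ _ (trans (Fin.punchIn-punchOut (f0≢ u)) eq))

∑∑-image : ∀ {k n} {f : Fin k → Fin n} → Injective _≡_ _≡_ f → (b : Fin n → Fin n → Bool) →
  (∀ x y → T (b x y) → (∃[ u ] f u ≡ x) × (∃[ v ] f v ≡ y)) → ∑∑ b ≡ ∑∑ (λ u v → b (f u) (f v))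
∑∑-image {k} {n} {f} inj b supported = trans
  (∑-image inj (λ x → ∑[ y < n ] ⟦ b x y ⟧) (λ x fu≢x →
    trans (sum-cong-≗ λ y → outside x y λ t → let (u , eq) , _ = supported x y t in fu≢x u eq) (sum-replicate-zero n)))
  (sum-cong-≗ λ u → ∑-image inj (λ y → ⟦ b (f u) y ⟧) λ y fv≢y →
    outside (f u) y λ t → let _ , (v , eq) = supported (f u) y t in fv≢y v eq)
  where
  outside : ∀ x y → ¬ T (b x y) → ⟦ b x y ⟧ ≡ 0
  outside x y ¬t with b x y
  ... | true  = contradiction _ ¬t
  ... | false = refl

-- Colored copies as embeddings

mono : ∀ {n} → Bool → Coloring n → Graph n
mono true  c = red c
mono false c = blue c

distinct≡true : ∀ {n} {x y : Fin n} → x ≢ y → distinct x y ≡ true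
distinct≡true {x = x} {y} x≢y = cong not (dec-false (x Fin.≟ y) x≢y)

adj⇒≢ : ∀ {n} (G : Graph n) {x y} → adj G x y ≡ true → x ≢ y
adj⇒≢ G {x} eq refl = contradiction (trans (sym eq) (adj-irref G x)) λ ()

blue≡not-red : ∀ {n} (c : Coloring n) {x y} → x ≢ y → adj (blue c) x y ≡ not (adj (red c) x y)
blue≡not-red c {x} {y} x≢y = cong (_∧ not (adj (red c) x y)) (distinct≡true x≢y)

-- Ordered pairs are counted, so each edge of `G` counts twice; hence the `2 * r` and `2 * b` in
-- `ColoredEmbedding`.
monoCount : ∀ {k n} → Graph k → Coloring n → Bool → (Fin k → Fin n) → ℕ
monoCount G c b f = ∑∑ (λ u v → adj G u v ∧ adj (mono b c) (f u) (f v))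

-- Injectivity sends the ends of an edge to distinct vertices, and on distinct vertices blue is the
-- negation of red.
monoCount-+ : ∀ {k n} (G : Graph k) (c : Coloring n) {f : Fin k → Fin n} → Injective _≡_ _≡_ f →
  monoCount G c true f + monoCount G c false f ≡ 2 * e G
monoCount-+ G c {f} inj = trans (∑∑-+ {d = adj G} one) (sym (2*e≡∑∑ G))
  where
  one : ∀ u v → ⟦ adj G u v ∧ adj (red c) (f u) (f v) ⟧ + ⟦ adj G u v ∧ adj (blue c) (f u) (f v) ⟧ ≡ ⟦ adj G u v ⟧
  one u v with adj G u v in eq
  ... | false = refl
  ... | true rewrite blue≡not-red c (adj⇒≢ G eq ∘ inj) with adj (red c) (f u) (f v)
  ...   | true  = refl
  ...   | false = refl

ColoredEmbedding : ∀ {k n} → Graph k → ℕ → ℕ → Coloring n → (Fin k → Fin n) → Set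
ColoredEmbedding G r b c f =
  Injective _≡_ _≡_ f × monoCount G c true f ≡ 2 * r × monoCount G c false f ≡ 2 * b

module _ {k n : ℕ} (G : Graph k) (f : Fin k → Fin n) (inj : Injective _≡_ _≡_ f) where

  private
    Image : Fin n → Set
    Image x = ∃[ u ] f u ≡ x

    image? : Decidable Image
    image? x = Fin.any? (λ u → f u Fin.≟ x)

    Joined : Fin n → Fin n → Set
    Joined x y = ∃[ u ] ∃[ v ] f u ≡ x × f v ≡ y × T (adj G u v)

    joined? : ∀ x y → Dec (Joined x y)
    joined? x y = Fin.any? λ u → Fin.any? λ v → (f u Fin.≟ x) ×-dec (f v Fin.≟ y) ×-dec T? (adj G u v)

    joined-sym : ∀ {x y} → Joined x y → Joined y x
    joined-sym (u , v , eu , ev , uv) = v , u , ev , eu , subst T (adj-sym G u v) uv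

    joined-irrefl : ∀ {x} → ¬ Joined x x
    joined-irrefl (u , v , eu , ev , uv) =
      adj⇒≢ G (Equivalence.to Bool.T-≡ uv) (inj (trans eu (sym ev)))

    vertexSet : Subset n
    vertexSet = Vec.tabulate (does ∘ image?)

    ∈-vertexSet⇔ : ∀ {x} → x ∈ vertexSet ⇔ Image x
    ∈-vertexSet⇔ {x} = mk⇔
      (λ x∈ → witness (image? x) (trans (sym (Vec.lookup∘tabulate (does ∘ image?) x)) (Vec.[]=⇒lookup x∈)))
      (λ im → Vec.lookup⇒[]= x vertexSet (trans (Vec.lookup∘tabulate (does ∘ image?) x) (dec-true (image? x) im)))
      where
      witness : ∀ {A : Set} (a? : Dec A) → does a? ≡ true → A
      witness (yes a) _ = a

  -- Only images of edges of `G` become edges, because a colored copy need not be an induced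
  -- subgraph.
  imageGraph : Graph n
  imageGraph = record
    { adj       = λ x y → does (joined? x y)
    ; adj-sym   = λ x y → does-⇔ (mk⇔ joined-sym joined-sym) (joined? x y) (joined? y x)
    ; adj-irref = λ x → dec-false (joined? x x) joined-irrefl
    }

  private
    imageGraph⇒Joined : ∀ {x y} → T (adj imageGraph x y) → Joined x y
    imageGraph⇒Joined {x} {y} t = toWitness (subst T (sym (isYes≗does (joined? x y))) t)

  image : Subgraph (complete n)
  image = record
    { vertices = vertexSet
    ; graph    = imageGraph
    ; ends     = λ t → let (u , v , eu , ev , _) = imageGraph⇒Joined t in
        Equivalence.from ∈-vertexSet⇔ (u , eu) , Equivalence.from ∈-vertexSet⇔ (v , ev)
    ; adj⊆     = λ {x} {y} t → Equivalence.from Bool.T-≡ (distinct≡true {x = x} {y} λ where refl → joined-irrefl (imageGraph⇒Joined t))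
    }

  ≅-image : G ≅ image
  ≅-image = record
    { map       = f
    ; injective = inj
    ; into      = λ u → Equivalence.from ∈-vertexSet⇔ (u , refl)
    ; onto      = Equivalence.to ∈-vertexSet⇔
    ; adj-resp  = λ u v → does-⇔ (mk⇔
        (λ (u′ , v′ , eu , ev , uv) → subst₂ (λ x y → T (adj G x y)) (inj eu) (inj ev) uv)
        (λ uv → u , v , refl , refl , uv)) (joined? (f u) (f v)) (T? (adj G u v))
    }

2*common-≅ : ∀ {k n} (G : Graph k) {S : Subgraph (complete n)} (iso : G ≅ S) (c : Coloring n) (b : Bool) →
  2 * common (graph S) (mono b c) ≡ monoCount G c b (_≅_.map iso)
2*common-≅ G {S} iso c b = begin
  2 * common (graph S) (mono b c)
    ≡⟨ 2*common≡∑∑ (graph S) (mono b c) ⟩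
  ∑∑ (λ x y → adj (graph S) x y ∧ adj (mono b c) x y)
    ≡⟨ ∑∑-image injective _ (λ x y t → let x∈ , y∈ = ends S (proj₁ (Equivalence.to Bool.T-∧ t)) in onto x∈ , onto y∈) ⟩
  ∑∑ (λ u v → adj (graph S) (f u) (f v) ∧ adj (mono b c) (f u) (f v))
    ≡⟨ ∑∑-cong (λ u v → cong (_∧ adj (mono b c) (f u) (f v)) (adj-resp u v)) ⟩
  monoCount G c b f ∎
  where
  open ≡-Reasoning
  open _≅_ iso using (injective; onto; adj-resp)
  f = _≅_.map iso

-- Reduces subgraphs with an isomorphism to injections between vertex sets, which can be enumerated
-- for the decision below and written down explicitly for the patterns.
copy⇔embedding : ∀ {k n} (G : Graph k) (r b : ℕ) (c : Coloring n) →
  HasColoredCopy G r b c ⇔ (∃[ f ] ColoredEmbedding G r b c f)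
copy⇔embedding G r b c = mk⇔
  (λ (S , iso , r≡ , b≡) → _≅_.map iso , _≅_.injective iso ,
    trans (sym (2*common-≅ G iso c true)) (cong (2 *_) r≡) , trans (sym (2*common-≅ G iso c false)) (cong (2 *_) b≡))
  (λ (f , inj , r≡ , b≡) → image G f inj , ≅-image G f inj ,
    *-cancelˡ-≡ _ _ 2 (trans (2*common-≅ G (≅-image G f inj) c true) r≡) ,
    *-cancelˡ-≡ _ _ 2 (trans (2*common-≅ G (≅-image G f inj) c false) b≡))

-- There are finitely many maps, coded by `finToFun`. A map and its decoded code agree only
-- pointwise, so injectivity and the two counts are transported along `f≗`.
copy? : ∀ {k n} (G : Graph k) (r b : ℕ) (c : Coloring n) → Dec (HasColoredCopy G r b c)
copy? {k} {n} G r b c = map′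
  (λ (i , inj , counts) → Equivalence.from (copy⇔embedding G r b c) (finToFun i , (λ {u} {v} → inj u v) , counts))
  (λ copy → let f , inj , r≡ , b≡ = Equivalence.to (copy⇔embedding G r b c) copy
                f≗ = Fin.finToFun-funToFin f
                same = λ d → ∑∑-cong λ u v → cong (adj G u v ∧_) (cong₂ (adj (mono d c)) (f≗ u) (f≗ v))
            in funToFin f , (λ u v eq → inj (trans (sym (f≗ u)) (trans eq (f≗ v)))) ,
               trans (same true) r≡ , trans (same false) b≡)
  (Fin.any? λ i →
    Fin.all? (λ u → Fin.all? λ v → (finToFun {n} {k} i u Fin.≟ finToFun i v) →-dec (u Fin.≟ v))
    ×-dec (monoCount G c true (finToFun i) ≟ 2 * r) ×-dec (monoCount G c false (finToFun i) ≟ 2 * b))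

-- Deciding whether a bound forces a copy

_≈_ : ∀ {n} → Coloring n → Coloring n → Set
c ≈ d = ∀ x y → adj (red c) x y ≡ adj (red d) x y

mono-cong : ∀ {n} {c d : Coloring n} → c ≈ d → ∀ b x y → adj (mono b c) x y ≡ adj (mono b d) x y
mono-cong c≈d true  x y = c≈d x y
mono-cong c≈d false x y = cong (λ t → distinct x y ∧ not t) (c≈d x y)

copy-resp-≈ : ∀ {k n} {G : Graph k} {r b : ℕ} {c d : Coloring n} → c ≈ d → HasColoredCopy G r b c → HasColoredCopy G r b d
copy-resp-≈ {G = G} {r} {b} {c} {d} c≈d copy =
  let f , inj , r≡ , b≡ = Equivalence.to (copy⇔embedding G r b c) copy
      same = λ t → ∑∑-cong λ u v → cong (adj G u v ∧_) (sym (mono-cong {c = c} {d} c≈d t (f u) (f v)))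
  in Equivalence.from (copy⇔embedding G r b d) (f , inj , trans (same true) r≡ , trans (same false) b≡)

e-mono-cong : ∀ {n} {c d : Coloring n} → c ≈ d → ∀ b → e (mono b c) ≡ e (mono b d)
e-mono-cong {c = c} {d} c≈d b = *-cancelˡ-≡ _ _ 2
  (trans (2*e≡∑∑ (mono b c)) (trans (∑∑-cong (mono-cong {c = c} {d} c≈d b)) (sym (2*e≡∑∑ (mono b d)))))

-- Symmetrizing the bit matrix and clearing its diagonal turns every subset into a coloring, so
-- `anySubset?` can search through all colorings up to `≈`.
decode : ∀ {n} → Subset (n * n) → Coloring n
decode s = record { red = record
  { adj       = λ x y → distinct x y ∧ (bit x y ∧ bit y x)
  ; adj-sym   = λ x y → cong₂ _∧_ (distinct-sym x y) (Bool.∧-comm (bit x y) (bit y x))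
  ; adj-irref = λ x → cong (_∧ (bit x x ∧ bit x x)) (distinct-irrefl x)
  } }
  where
  bit : ∀ x y → Bool
  bit x y = Vec.lookup s (combine x y)

encode : ∀ {n} → Coloring n → Subset (n * n)
encode {n} c = Vec.tabulate (uncurry (adj (red c)) ∘ remQuot n)

decode-encode : ∀ {n} (c : Coloring n) → decode (encode c) ≈ c
decode-encode {n} c x y = begin
  distinct x y ∧ (bit x y ∧ bit y x)                   ≡⟨ cong (distinct x y ∧_) (cong₂ _∧_ (bit≡ x y) (trans (bit≡ y x) (adj-sym (red c) y x))) ⟩
  distinct x y ∧ (adj (red c) x y ∧ adj (red c) x y)   ≡⟨ cong (distinct x y ∧_) (Bool.∧-idem (adj (red c) x y)) ⟩
  distinct x y ∧ adj (red c) x y                       ≡⟨ absorb ⟩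
  adj (red c) x y                                      ∎
  where
  open ≡-Reasoning
  bit : ∀ x y → Bool
  bit x y = Vec.lookup (encode c) (combine x y)

  bit≡ : ∀ x y → bit x y ≡ adj (red c) x y
  bit≡ x y = trans (Vec.lookup∘tabulate (uncurry (adj (red c)) ∘ remQuot n) (combine x y))
                   (cong (uncurry (adj (red c))) (Fin.remQuot-combine x y))

  absorb : distinct x y ∧ adj (red c) x y ≡ adj (red c) x y
  absorb with adj (red c) x y in eq
  ... | true  = trans (Bool.∧-identityʳ _) (distinct≡true (adj⇒≢ (red c) eq))
  ... | false = Bool.∧-zeroʳ _

-- `IsBal` asks for a least forcing `s`; decidability allows it to be found by search.
forces? : ∀ {k} (G : Graph k) (r n s : ℕ) → Dec (Forces G r n s)
forces? G r n s = map′ unavoided⇒forces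
  (λ forces (t , large , ¬copy) → ¬copy (forces (decode t) large))
  (¬? (anySubset? (avoids? ∘ decode)))
  where
  copy₁? : (c : Coloring n) → Dec (HasColoredCopy G r (e G ∸ r) c)
  copy₁? = copy? G r (e G ∸ r)

  copy₂? : (c : Coloring n) → Dec (HasColoredCopy G (e G ∸ r) r c)
  copy₂? = copy? G (e G ∸ r) r

  Avoids : Coloring n → Set
  Avoids c = e (red c) ⊓ e (blue c) > s × ¬ (HasColoredCopy G r (e G ∸ r) c ⊎ HasColoredCopy G (e G ∸ r) r c)

  avoids? : Decidable Avoids
  avoids? c = (s <? e (red c) ⊓ e (blue c)) ×-dec ¬? (copy₁? c ⊎-dec copy₂? c)

  -- The search only covers colorings of the form `decode t`. An arbitrary `c` is compared with
  -- `decode (encode c)`, which has the same edge numbers and the same copies.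
  unavoided⇒forces : ¬ (∃[ t ] Avoids (decode t)) → Forces G r n s
  unavoided⇒forces none c large = decidable-stable (copy₁? c ⊎-dec copy₂? c) λ ¬copy →
    none (encode c ,
      subst₂ (λ i j → i ⊓ j > s) (e-mono-cong {c = c} {c′} forth true) (e-mono-cong {c = c} {c′} forth false) large ,
      ¬copy ∘ Sum.map (copy-resp-≈ {c = c′} {c} back) (copy-resp-≈ {c = c′} {c} back))
    where
    c′ : Coloring n
    c′ = decode (encode c)

    back : c′ ≈ c
    back = decode-encode c

    forth : c ≈ c′
    forth x y = sym (back x y)

least : {P : ℕ → Set} → Decidable P → ∀ {m} → P m → ∃[ s ] (P s × (∀ s′ → P s′ → s ≤ s′)) × s ≤ m
least P? {m} pm with P? 0
... | yes p0 = 0 , (p0 , λ _ _ → z≤n) , z≤n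
least P? {zero}  pm | no ¬p0 = contradiction pm ¬p0
least {P} P? {suc m} pm | no ¬p0 =
  let s , (ps , min) , s≤m = least (P? ∘ suc) pm
  in suc s , (ps , λ where zero p → contradiction p ¬p0
                           (suc s′) p → s≤s (min s′ p)) , s≤s s≤m

-- Balanced colorings

2*nC2+n≡n*n : ∀ n → 2 * (n C 2) + n ≡ n * n
2*nC2+n≡n*n zero    = refl
2*nC2+n≡n*n (suc n) = begin
  2 * (suc n C 2) + suc n            ≡⟨ cong (λ m → 2 * m + suc n) (nCk+nC[k+1]≡[n+1]C[k+1] n 1) ⟨
  2 * (n C 1 + n C 2) + suc n        ≡⟨ cong (λ m → 2 * (m + n C 2) + suc n) (nC1≡n n) ⟩
  2 * (n + n C 2) + suc n            ≡⟨ regroup n (n C 2) ⟩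
  (2 * (n C 2) + n) + (2 * n + 1)    ≡⟨ cong (_+ (2 * n + 1)) (2*nC2+n≡n*n n) ⟩
  n * n + (2 * n + 1)                ≡⟨ square n ⟩
  suc n * suc n                      ∎
  where
  open ≡-Reasoning
  regroup : ∀ n c → 2 * (n + c) + suc n ≡ (2 * c + n) + (2 * n + 1)
  regroup = solve-∀
  square : ∀ n → n * n + (2 * n + 1) ≡ suc n * suc n
  square = solve-∀

∑-const : ∀ n m → ∑[ x < n ] m ≡ n * m
∑-const zero    m = refl
∑-const (suc n) m = cong (m +_) (∑-const n m)

∑-* : ∀ {m n} (f : Fin m → ℕ) (g : Fin n → ℕ) →
  ∑[ x < m ] ∑[ y < n ] (f x * g y) ≡ (∑[ x < m ] f x) * (∑[ y < n ] g y)
∑-* {m} {n} f g = trans (sum-cong-≗ λ x → sym (*-distribˡ-sum (f x) g)) (sym (*-distribʳ-sum (∑[ y < n ] g y) f))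

∑∑-∧ : ∀ {m n} (s : Fin m → Bool) (t : Fin n → Bool) →
  ∑∑ (λ x y → s x ∧ t y) ≡ (∑[ x < m ] ⟦ s x ⟧) * (∑[ y < n ] ⟦ t y ⟧)
∑∑-∧ s t = trans (sum-cong-≗ λ x → sum-cong-≗ λ y → ⟦∧⟧ (s x) (t y)) (∑-* (λ x → ⟦ s x ⟧) (λ y → ⟦ t y ⟧))
  where
  ⟦∧⟧ : ∀ s t → ⟦ s ∧ t ⟧ ≡ ⟦ s ⟧ * ⟦ t ⟧
  ⟦∧⟧ true  t = sym (+-identityʳ ⟦ t ⟧)
  ⟦∧⟧ false t = refl

∑-≟ : ∀ {n} (x : Fin n) (t : Bool) → ∑[ y < n ] ⟦ does (x Fin.≟ y) ∧ t ⟧ ≡ ⟦ t ⟧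
∑-≟ {suc n} zero    t = trans (cong (⟦ t ⟧ +_) (sum-replicate-zero n)) (+-identityʳ ⟦ t ⟧)
∑-≟ {suc n} (suc x) t = ∑-≟ x t

∑-<ᵇ : ∀ a b → ∑[ x < a + b ] ⟦ toℕ x <ᵇ a ⟧ ≡ a
∑-<ᵇ zero    b = sum-replicate-zero b
∑-<ᵇ (suc a) b = cong suc (∑-<ᵇ a b)

∑-≮ᵇ : ∀ a b → ∑[ x < a + b ] ⟦ not (toℕ x <ᵇ a) ⟧ ≡ b
∑-≮ᵇ zero    b = trans (∑-const b 1) (*-identityʳ b)
∑-≮ᵇ (suc a) b = ∑-≮ᵇ a b

cliqueColoring : ∀ {n} → (Fin n → Bool) → Coloring n
cliqueColoring p = record { red = record
  { adj       = λ x y → distinct x y ∧ (p x ∧ p y)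
  ; adj-sym   = λ x y → cong₂ _∧_ (distinct-sym x y) (Bool.∧-comm (p x) (p y))
  ; adj-irref = λ x → cong (_∧ (p x ∧ p x)) (distinct-irrefl x)
  } }

cutColoring : ∀ {n} → (Fin n → Bool) → Coloring n
cutColoring p = record { red = record
  { adj       = λ x y → p x xor p y
  ; adj-sym   = λ x y → Bool.xor-comm (p x) (p y)
  ; adj-irref = λ x → Bool.xor-same (p x)
  } }

-- Adding the m diagonal pairs of the clique to its ordered edges completes the square of its vertex
-- set.
∑∑-cliqueColoring : ∀ {n} (p : Fin n → Bool) → let m = ∑[ x < n ] ⟦ p x ⟧ in
  ∑∑ (adj (red (cliqueColoring p))) + m ≡ m * m
∑∑-cliqueColoring {n} p = begin
  ∑∑ (adj (red (cliqueColoring p))) + ∑[ x < n ] ⟦ p x ⟧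
    ≡⟨ cong (∑∑ (adj (red (cliqueColoring p))) +_) (sum-cong-≗ λ x → ∑-≟ x (p x)) ⟨
  ∑∑ (adj (red (cliqueColoring p))) + ∑∑ (λ x y → does (x Fin.≟ y) ∧ p x)
    ≡⟨ ∑∑-+ {d = λ x y → p x ∧ p y} split ⟩
  ∑∑ (λ x y → p x ∧ p y)
    ≡⟨ ∑∑-∧ p p ⟩
  (∑[ x < n ] ⟦ p x ⟧) * (∑[ x < n ] ⟦ p x ⟧) ∎
  where
  open ≡-Reasoning
  split : ∀ x y → ⟦ distinct x y ∧ (p x ∧ p y) ⟧ + ⟦ does (x Fin.≟ y) ∧ p x ⟧ ≡ ⟦ p x ∧ p y ⟧
  split x y with x Fin.≟ y
  ... | yes refl = cong ⟦_⟧ (sym (Bool.∧-idem (p x)))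
  ... | no _     = +-identityʳ _

∑∑-cutColoring : ∀ {n} (p : Fin n → Bool) → let a = ∑[ x < n ] ⟦ p x ⟧ ; b = ∑[ x < n ] ⟦ not (p x) ⟧ in
  ∑∑ (adj (red (cutColoring p))) ≡ a * b + b * a
∑∑-cutColoring {n} p = begin
  ∑∑ (λ x y → p x xor p y)
    ≡⟨ ∑∑-+ {b = λ x y → p x ∧ not (p y)} {λ x y → not (p x) ∧ p y} (λ x y → split (p x) (p y)) ⟨
  ∑∑ (λ x y → p x ∧ not (p y)) + ∑∑ (λ x y → not (p x) ∧ p y)
    ≡⟨ cong₂ _+_ (∑∑-∧ p (not ∘ p)) (∑∑-∧ (not ∘ p) p) ⟩
  (∑[ x < n ] ⟦ p x ⟧) * (∑[ x < n ] ⟦ not (p x) ⟧) + (∑[ x < n ] ⟦ not (p x) ⟧) * (∑[ x < n ] ⟦ p x ⟧) ∎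
  where
  open ≡-Reasoning
  split : ∀ s t → ⟦ s ∧ not t ⟧ + ⟦ not s ∧ t ⟧ ≡ ⟦ s xor t ⟧
  split true  t = +-identityʳ _
  split false t = refl

e-red+e-blue : ∀ {n} (c : Coloring n) → e (red c) + e (blue c) ≡ n C 2
e-red+e-blue {n} c = *-cancelˡ-≡ _ _ 2 (+-cancelʳ-≡ n _ _ (begin
  2 * (e (red c) + e (blue c)) + n
    ≡⟨ cong (_+ n) (*-distribˡ-+ 2 (e (red c)) _) ⟩
  2 * e (red c) + 2 * e (blue c) + n
    ≡⟨ cong (_+ n) (cong₂ _+_ (2*e≡∑∑ (red c)) (2*e≡∑∑ (blue c))) ⟩
  ∑∑ (adj (red c)) + ∑∑ (adj (blue c)) + n
    ≡⟨ cong (_+ n) (∑∑-+ {d = adj (red all)} split) ⟩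
  ∑∑ (adj (red all)) + n
    ≡⟨ cong (∑∑ (adj (red all)) +_) ∑1 ⟨
  ∑∑ (adj (red all)) + ∑[ x < n ] 1
    ≡⟨ ∑∑-cliqueColoring {n} (λ _ → true) ⟩
  (∑[ x < n ] 1) * (∑[ x < n ] 1)
    ≡⟨ cong₂ _*_ ∑1 ∑1 ⟩
  n * n
    ≡⟨ 2*nC2+n≡n*n n ⟨
  2 * (n C 2) + n ∎))
  where
  open ≡-Reasoning
  all : Coloring n
  all = cliqueColoring (λ _ → true)

  ∑1 : ∑[ x < n ] 1 ≡ n
  ∑1 = trans (∑-const n 1) (*-identityʳ n)

  split : ∀ x y → ⟦ adj (red c) x y ⟧ + ⟦ adj (blue c) x y ⟧ ≡ ⟦ distinct x y ∧ true ⟧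
  split x y with x Fin.≟ y
  ... | yes refl rewrite adj-irref (red c) x = refl
  ... | no _ with adj (red c) x y
  ...   | true  = refl
  ...   | false = refl

-- The hypothesis says 4e(R) = n(n-1), that is, exactly half of the edges are red; then the other
-- half is blue.
balanced : ∀ {n} (c : Coloring n) → 2 * ∑∑ (adj (red c)) + n ≡ n * n → e (red c) ⊓ e (blue c) ≡ ⌊ n C 2 /2⌋
balanced {n} c half = begin
  i ⊓ e (blue c)     ≡⟨ cong (i ⊓_) blue≡red ⟩
  i ⊓ i              ≡⟨ ⊓-idem i ⟩
  i                  ≡⟨ n≡⌊n+n/2⌋ i ⟩
  ⌊ i + i /2⌋        ≡⟨ cong ⌊_/2⌋ i+i≡nC2 ⟩
  ⌊ n C 2 /2⌋        ∎
  where
  open ≡-Reasoning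
  i = e (red c)

  i+i≡nC2 : i + i ≡ n C 2
  i+i≡nC2 = trans (cong (i +_) (sym (+-identityʳ i))) (trans (2*e≡∑∑ (red c))
    (*-cancelˡ-≡ _ _ 2 (+-cancelʳ-≡ n _ _ (trans half (sym (2*nC2+n≡n*n n))))))

  blue≡red : e (blue c) ≡ i
  blue≡red = +-cancelˡ-≡ i _ _ (trans (e-red+e-blue c) (sym i+i≡nC2))

-- Here n = 2t + m = m², and the parts have t and t + m vertices. So 4t(t+m) + n = 4t(t+m) + m² =
-- (2t+m)² = n².
cutColoring-balanced : ∀ t m → 2 * t + m ≡ m * m → let n = t + (t + m) ; c = cutColoring {n} (λ x → toℕ x <ᵇ t) in
  e (red c) ⊓ e (blue c) ≡ ⌊ n C 2 /2⌋
cutColoring-balanced t m tri = balanced (cutColoring {n} p) (begin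
  2 * ∑∑ (adj (red (cutColoring {n} p))) + n            ≡⟨ cong (λ s → 2 * s + n) (∑∑-cutColoring {n} p) ⟩
  2 * (a * b + b * a) + n                               ≡⟨ cong₂ (λ a b → 2 * (a * b + b * a) + n) (∑-<ᵇ t (t + m)) (∑-≮ᵇ t (t + m)) ⟩
  2 * (t * (t + m) + (t + m) * t) + n                   ≡⟨ expand t m ⟩
  4 * (t * t) + 4 * (t * m) + (2 * t + m)               ≡⟨ cong (4 * (t * t) + 4 * (t * m) +_) tri ⟩
  4 * (t * t) + 4 * (t * m) + m * m                     ≡⟨ square t m ⟩
  n * n                                                 ∎)
  where
  open ≡-Reasoning
  n = t + (t + m)
  p : Fin n → Bool
  p x = toℕ x <ᵇ t
  a = ∑[ x < n ] ⟦ p x ⟧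
  b = ∑[ x < n ] ⟦ not (p x) ⟧
  expand : ∀ t m → 2 * (t * (t + m) + (t + m) * t) + (t + (t + m)) ≡ 4 * (t * t) + 4 * (t * m) + (2 * t + m)
  expand = solve-∀
  square : ∀ t m → 4 * (t * t) + 4 * (t * m) + m * m ≡ (t + (t + m)) * (t + (t + m))
  square = solve-∀

-- With n = q + l + 1 the hypothesis reads 2(q+1)q = n(n-1): the clique on q + 1 vertices has half
-- of the edges.
cliqueColoring-balanced : ∀ q l → 2 * (q * suc q) ≡ (q + l) * suc (q + l) →
  let n = suc q + l ; c = cliqueColoring {n} (λ x → toℕ x <ᵇ suc q) in
  e (red c) ⊓ e (blue c) ≡ ⌊ n C 2 /2⌋
cliqueColoring-balanced q l pell = balanced c (begin
  2 * ∑∑ (adj (red c)) + n                ≡⟨ cong (λ s → 2 * s + n) ∑∑red ⟩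
  2 * (q * suc q) + n                     ≡⟨ cong (_+ n) pell ⟩
  (q + l) * suc (q + l) + n               ≡⟨ square (q + l) ⟩
  n * n                                   ∎)
  where
  open ≡-Reasoning
  n = suc q + l
  c : Coloring n
  c = cliqueColoring (λ x → toℕ x <ᵇ suc q)

  ∑∑red : ∑∑ (adj (red c)) ≡ q * suc q
  ∑∑red = +-cancelʳ-≡ (suc q) _ _ (trans
    (subst (λ m → ∑∑ (adj (red c)) + m ≡ m * m) (∑-<ᵇ (suc q) l) (∑∑-cliqueColoring {n} (λ x → toℕ x <ᵇ suc q)))
    (+-comm (suc q) (q * suc q)))

  square : ∀ k → k * suc k + suc k ≡ suc k * suc k
  square = solve-∀

-- The solutions of the Pell equation u² - 2v² = -1, with u = 2(q + l) + 1 and v = 2q + 1.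
pell : ∀ i → ∃[ q ] ∃[ l ] i ≤ l × 2 * (q * suc q) ≡ (q + l) * suc (q + l)
pell zero    = 0 , 0 , z≤n , refl
pell (suc i) = let q , l , i≤l , eq = pell i
                   next = 5 * q + 2 * l + 2 in
  -- Multiplying u + v√2 by the unit 3 + 2√2 gives 3u + 4v and 2u + 3v in place of u and v. In terms
  -- of q and l these are the two witnesses.
  5 * q + 2 * l + 2 , 2 * q + l + 1 ,
  ≤-trans (s≤s (≤-trans i≤l (m≤n+m l (2 * q)))) (≤-reflexive (+-comm 1 (2 * q + l))) ,
  -- The two sides of the equation differ by the same amount for the old and the new pair; adding
  -- the old sides crosswise states this without subtraction.
  +-cancelʳ-≡ (2 * (q * suc q)) _ _ (trans (cong (2 * (next * suc next) +_) eq) (step q l))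
  where
  step : ∀ q l →
    2 * ((5 * q + 2 * l + 2) * suc (5 * q + 2 * l + 2)) + (q + l) * suc (q + l)
    ≡ (5 * q + 2 * l + 2 + (2 * q + l + 1)) * suc (5 * q + 2 * l + 2 + (2 * q + l + 1)) + 2 * (q * suc q)
  step = solve-∀

-- From tonality to the partition and the induced subgraph

tonal⇒embedding : ∀ {k} {G : Graph k} {r : ℕ} ((N , _) : Tonal r G) {n : ℕ} → n ≥ N →
  (c : Coloring n) → e (red c) ⊓ e (blue c) ≡ ⌊ n C 2 /2⌋ →
  ∃[ f ] Injective _≡_ _≡_ f × (monoCount G c true f ≡ 2 * r ⊎ monoCount G c true f ≡ 2 * (e G ∸ r))
-- Tonality puts the balancing number strictly below half of the edges, which is the minimum
-- attained by `c`, so `c` contains a copy. Keeping its red count is enough: this is r or e(G) - r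
-- whichever kind of copy occurs.
tonal⇒embedding {G = G} {r} (N , bal) {n} n≥N c half with bal n n≥N
... | s , (forces , _) , s< with forces c (subst (s <_) (sym half) s<)
...   | inj₁ copy = let f , inj , r≡ , _ = Equivalence.to (copy⇔embedding G r (e G ∸ r) c) copy in f , inj , inj₁ r≡
...   | inj₂ copy = let f , inj , r≡ , _ = Equivalence.to (copy⇔embedding G (e G ∸ r) r c) copy in f , inj , inj₂ r≡

does-∈?-tabulate : ∀ {k} (p : Fin k → Bool) (u : Fin k) → does (u ∈? Vec.tabulate p) ≡ p u
does-∈?-tabulate {k} p u = trans
  (does-⇔ (mk⇔ (λ u∈ → trans (sym lookup≡) (Vec.[]=⇒lookup u∈)) (λ eq → Vec.lookup⇒[]= u _ (trans lookup≡ eq))) (u ∈? Vec.tabulate p) (p u Bool.≟ true))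
  (decide (p u))
  where
  lookup≡ : Vec.lookup (Vec.tabulate p) u ≡ p u
  lookup≡ = Vec.lookup∘tabulate p u

  decide : ∀ b → does (b Bool.≟ true) ≡ b
  decide true  = refl
  decide false = refl

partition⇒∁ : ∀ {k} {X Y : Subset k} → IsPartition X Y → ∀ u → does (u ∈? Y) ≡ not (does (u ∈? X))
partition⇒∁ {X = X} {Y} (X∪Y , X∩Y) u = does-⇔ (mk⇔ to from) (u ∈? Y) (¬? (u ∈? X))
  where
  to : u ∈ Y → ¬ u ∈ X
  to u∈Y u∈X = ∉⊥ (subst (u ∈_) X∩Y (x∈p∩q⁺ (u∈X , u∈Y)))

  from : ¬ u ∈ X → u ∈ Y
  from u∉X with x∈p∪q⁻ X Y (subst (u ∈_) (sym X∪Y) ∈⊤)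
  ... | inj₁ u∈X = contradiction u∈X u∉X
  ... | inj₂ u∈Y = u∈Y

-- Brings the cut into the form of the red graph of `cutColoring`: an edge crosses exactly when its
-- ends differ in membership of `X`.
2*eBetween-partition : ∀ {k} (G : Graph k) {X Y : Subset k} → IsPartition X Y →
  2 * eBetween G X Y ≡ ∑∑ (λ u v → adj G u v ∧ (does (u ∈? X) xor does (v ∈? X)))
2*eBetween-partition G {X} {Y} part = trans (2*eBetween≡∑∑ G X Y) (∑∑-cong λ u v → cong (adj G u v ∧_)
  (trans (cong₂ (λ s t → does (u ∈? X) ∧ t ∨ s ∧ does (v ∈? X)) (partition⇒∁ part u) (partition⇒∁ part v))
         (xor-def (does (u ∈? X)) (does (v ∈? X)))))
  where
  xor-def : ∀ s t → s ∧ not t ∨ not s ∧ t ≡ s xor t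
  xor-def true  t = Bool.∨-identityʳ (not t)
  xor-def false t = refl

halves : ∀ {i j r s} → 2 * i ≡ j → j ≡ 2 * r ⊎ j ≡ 2 * s → i ≡ r ⊎ i ≡ s
halves eq = Sum.map (*-cancelˡ-≡ _ _ 2 ∘ trans eq) (*-cancelˡ-≡ _ _ 2 ∘ trans eq)

-- The cut of K_n, n = N², into parts of sizes N(N-1)/2 and N(N+1)/2 contains half of the edges.
tonal⇒partition : ∀ {k} (G : Graph k) (r : ℕ) → Tonal r G →
  Σ[ X ∈ Subset k ] Σ[ Y ∈ Subset k ] (IsPartition X Y × (eBetween G X Y ≡ r ⊎ eBetween G X Y ≡ e G ∸ r))
tonal⇒partition {k} G r tonal@(N , _) =
  let f , inj , counts = tonal⇒embedding tonal large (cutColoring p) (cutColoring-balanced t N tri)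
      X = Vec.tabulate (p ∘ f)
      part = p∪∁p≡⊤ X , ∩-inverseʳ X
  in X , ∁ X , part , halves
    (trans (2*eBetween-partition G part) (∑∑-cong λ u v → cong (adj G u v ∧_)
      (cong₂ _xor_ (does-∈?-tabulate (p ∘ f) u) (does-∈?-tabulate (p ∘ f) v)))) counts
  where
  t n : ℕ
  t = N C 2
  n = t + (t + N)

  tri : 2 * t + N ≡ N * N
  tri = 2*nC2+n≡n*n N

  large : n ≥ N
  large = ≤-trans (m≤n+m N t) (m≤n+m (t + N) t)

  p : Fin n → Bool
  p x = toℕ x <ᵇ t

-- `pell N` supplies a half-sized red clique in a complete graph with at least N vertices. With W
-- the preimage of the clique, the red edges of the copy are those of G[W].
tonal⇒induced : ∀ {k} (G : Graph k) (r : ℕ) → Tonal r G →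
  Σ[ W ∈ Subset k ] (e (graph (induced G W)) ≡ r ⊎ e (graph (induced G W)) ≡ e G ∸ r)
tonal⇒induced {k} G r tonal@(N , _) with pell N
... | q , l , N≤l , eq =
  let f , inj , counts = tonal⇒embedding tonal (≤-trans N≤l (m≤n+m l (suc q))) (cliqueColoring p) (cliqueColoring-balanced q l eq)
      W = Vec.tabulate (p ∘ f)
  in W , halves (trans (2*e≡∑∑ (graph (induced G W))) (∑∑-cong (same f inj))) counts
  where
  p : Fin (suc q + l) → Bool
  p x = toℕ x <ᵇ suc q

  same : ∀ f → Injective _≡_ _≡_ f → ∀ u v → let W = Vec.tabulate (p ∘ f) in
    adj G u v ∧ (does (u ∈? W) ∧ does (v ∈? W)) ≡ adj G u v ∧ (distinct (f u) (f v) ∧ (p (f u) ∧ p (f v)))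
  same f inj u v with adj G u v in uv
  ... | false = refl
  ... | true rewrite distinct≡true (adj⇒≢ G uv ∘ inj) = cong₂ _∧_ (does-∈?-tabulate (p ∘ f) u) (does-∈?-tabulate (p ∘ f) v)

-- Unavoidable patterns

AllPairs-lookup : {R : Rel A ℓ} → Symmetric R → {xs : List A} → AllPairs R xs →
  ∀ i j → i ≢ j → R (lookup xs i) (lookup xs j)
AllPairs-lookup R-sym (_ ∷ _)  zero    zero    0≢0 = contradiction refl 0≢0
AllPairs-lookup R-sym (p ∷ _)  zero    (suc j) _   = All.lookup p (List.∈-lookup j)
AllPairs-lookup R-sym (p ∷ _)  (suc i) zero    _   = R-sym (All.lookup p (List.∈-lookup i))
AllPairs-lookup R-sym (_ ∷ ps) (suc i) (suc j) i≢j = AllPairs-lookup R-sym ps i j (i≢j ∘ cong suc)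

AllPairs-∈ : {R : Rel A ℓ} → Symmetric R → {xs : List A} → AllPairs R xs →
  ∀ {x y} → x List.∈ xs → y List.∈ xs → x ≢ y → R x y
AllPairs-∈ {R = R} R-sym {xs} pairs x∈ y∈ x≢y = subst₂ R (sym (lookup-index x∈)) (sym (lookup-index y∈))
  (AllPairs-lookup R-sym pairs (index x∈) (index y∈)
    λ eq → x≢y (trans (lookup-index x∈) (trans (cong (lookup xs) eq) (sym (lookup-index y∈)))))

sum-map-tabulate : {n : ℕ} (f : A → ℕ) (g : Fin n → A) → sum (map f (tabulate g)) ≡ ∑[ i < n ] f (g i)
sum-map-tabulate {n = zero}  f g = refl
sum-map-tabulate {n = suc n} f g = cong (f (g zero) +_) (sum-map-tabulate f (g ∘ suc))

sum-degree-allFin : ∀ {n} (G : Graph n) → sum (map (degree (adj G) (allFin n)) (allFin n)) ≡ 2 * e G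
sum-degree-allFin {n} G = begin
  sum (map (degree (adj G) (allFin n)) (allFin n))   ≡⟨ sum-map-tabulate (degree (adj G) (allFin n)) id ⟩
  ∑[ x < n ] degree (adj G) (allFin n) x             ≡⟨ (sum-cong-≗ λ x → sum-map-tabulate (λ v → ⟦ adj G v x ⟧) id) ⟩
  ∑[ x < n ] ∑[ v < n ] ⟦ adj G v x ⟧                ≡⟨ ∑-comm (λ x v → ⟦ adj G v x ⟧) ⟩
  ∑∑ (adj G)                                         ≡⟨ 2*e≡∑∑ G ⟨
  2 * e G                                            ∎
  where open ≡-Reasoning

m≤2*⌊m/2⌋+1 : ∀ m → m ≤ 2 * ⌊ m /2⌋ + 1
m≤2*⌊m/2⌋+1 zero          = z≤n
m≤2*⌊m/2⌋+1 (suc zero)    = s≤s z≤n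
m≤2*⌊m/2⌋+1 (suc (suc m)) = ≤-trans (s≤s (s≤s (m≤2*⌊m/2⌋+1 m))) (≤-reflexive (step ⌊ m /2⌋))
  where
  step : ∀ h → suc (suc (2 * h + 1)) ≡ 2 * suc h + 1
  step = solve-∀

-- With half of the edges, 8 times the degree sum is about 4n², while only n² is claimed. The spare
-- 3n² absorbs the terms 4n + 8 coming from the diagonal and from rounding.
dense : ∀ {n} (G : Graph n) → 3 ≤ n → ⌊ n C 2 /2⌋ ≤ e G →
  n * n ≤ 8 * sum (map (degree (adj G) (allFin n)) (allFin n))
dense {n} G 3≤n half≤ = subst (λ s → n * n ≤ 8 * s) (sym (sum-degree-allFin G))
  (+-cancelʳ-≤ (3 * (n * n)) _ _ (begin
  n * n + 3 * (n * n)                ≡⟨ four (n * n) ⟩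
  4 * (n * n)                        ≡⟨ cong (4 *_) (2*nC2+n≡n*n n) ⟨
  4 * (2 * (n C 2) + n)              ≤⟨ *-monoʳ-≤ 4 (+-monoˡ-≤ n (*-monoʳ-≤ 2
                                          (≤-trans (m≤2*⌊m/2⌋+1 (n C 2)) (+-monoˡ-≤ 1 (*-monoʳ-≤ 2 half≤))))) ⟩
  4 * (2 * (2 * e G + 1) + n)        ≡⟨ expand (e G) n ⟩
  8 * (2 * e G) + (4 * n + 8)        ≤⟨ +-monoʳ-≤ (8 * (2 * e G)) small ⟩
  8 * (2 * e G) + 3 * (n * n)        ∎))
  where
  open ≤-Reasoning
  four : ∀ m → m + 3 * m ≡ 4 * m
  four = solve-∀
  expand : ∀ i n → 4 * (2 * (2 * i + 1) + n) ≡ 8 * (2 * i) + (4 * n + 8)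
  expand = solve-∀
  regroup : ∀ n → 4 * n + 3 * n + 2 * n ≡ 3 * (3 * n)
  regroup = solve-∀
  small : 4 * n + 8 ≤ 3 * (n * n)
  small = begin
    4 * n + 8               ≤⟨ +-monoʳ-≤ (4 * n) (≤-trans (n≤1+n 8) (*-monoʳ-≤ 3 3≤n)) ⟩
    4 * n + 3 * n           ≤⟨ m≤m+n _ (2 * n) ⟩
    4 * n + 3 * n + 2 * n   ≡⟨ regroup n ⟩
    3 * (3 * n)             ≤⟨ *-monoʳ-≤ 3 (*-monoˡ-≤ n 3≤n) ⟩
    3 * (n * n)             ∎

Clique : ∀ {n} → Graph n → List (Fin n) → Set
Clique G = AllPairs (λ x y → adj G x y ≡ true)

adj-symmetric : ∀ {n} (G : Graph n) → Symmetric (λ x y → adj G x y ≡ true)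
adj-symmetric G {x} {y} = trans (adj-sym G y x)

Complete-swap : ∀ {n} (G : Graph n) {xs ys : List (Fin n)} → Complete (adj G) xs ys → Complete (adj G) ys xs
Complete-swap G full = All.tabulate λ y∈ → All.tabulate λ x∈ →
  adj-symmetric G (All.lookup (All.lookup full x∈) y∈)

adj-mono-red : ∀ {n} (c : Coloring n) {b x y} → x ≢ y → adj (red c) x y ≡ b → adj (mono b c) x y ≡ true
adj-mono-red c {true}  x≢y eq = eq
adj-mono-red c {false} x≢y eq = trans (blue≡not-red c x≢y) (cong not eq)

-- `not (b xor d)` is the equality test for the two colours.
adj-mono-mono : ∀ {n} (c : Coloring n) b d {x y} → adj (mono b c) x y ≡ true → adj (mono d c) x y ≡ not (b xor d)
adj-mono-mono c true  true  eq = eq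
adj-mono-mono c true  false eq = trans (blue≡not-red c (adj⇒≢ (red c) eq)) (cong not eq)
adj-mono-mono c false false eq = eq
adj-mono-mono c false true  eq = Bool.not-injective (trans (sym (blue≡not-red c (adj⇒≢ (blue c) eq))) eq)

mono-clique : ∀ {n} (c : Coloring n) (t : ℕ) (xs : List (Fin n)) → Unique xs → ramseyBound (2 * t) ≤ length xs →
  ∃[ b ] ∃[ ys ] ys ⊆ xs × t ≤ length ys × Clique (mono b c) ys
mono-clique c t xs unique bound =
  let b , ys , ys⊆ , t≤ , homog = ramsey (adj (red c)) t xs bound
  in b , ys , ys⊆ , t≤ , AllPairs.zipWith (uncurry (adj-mono-red c)) (AllPairs-resp-⊆ ys⊆ unique , homog)

degree-red+blue : ∀ {n} (c : Coloring n) {vs : List (Fin n)} {x} → All (λ v → v ≢ x) vs →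
  degree (adj (red c)) vs x + degree (adj (blue c)) vs x ≡ length vs
degree-red+blue c []                          = refl
degree-red+blue c {v ∷ vs} {x} (v≢x ∷ vs≢x) rewrite blue≡not-red c v≢x with adj (red c) v x
... | true  = cong suc (degree-red+blue c vs≢x)
... | false = trans (+-suc _ _) (cong suc (degree-red+blue c vs≢x))

-- Each `x` has at least t neighbours of some colour among the 2t vertices of `vs`. One colour
-- serves half of `xs`, whence the leading factor 2, and `biclique` applies in that colour.
bipartite-ramsey : ∀ {n} (c : Coloring n) (t : ℕ) (vs xs : List (Fin n)) → length vs ≡ 2 * t →
  2 * (2 ^ length vs * suc t) ≤ length xs → All (λ x → All (λ v → v ≢ x) vs) xs →
  ∃[ d ] ∃[ us ] ∃[ ys ] us ⊆ vs × ys ⊆ xs × t ≤ length us × t ≤ length ys × Complete (adj (mono d c)) us ys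
bipartite-ramsey {n} c t vs xs len large disjoint
  with halve (λ x → t ≤ᵇ degree (adj (red c)) vs x) xs (2 ^ length vs * suc t) large
... | true , ys , ys⊆ , many , large′ =
  let us , zs , us⊆ , zs⊆ , rest = biclique (adj (red c)) t t vs ys
        (All.map (λ {x} eq → ≤ᵇ⇒≤ t (degree (adj (red c)) vs x) (Equivalence.from Bool.T-≡ eq)) many) large′
  in true , us , zs , us⊆ , ⊆-trans zs⊆ ys⊆ , rest
... | false , ys , ys⊆ , few , large′ =
  let us , zs , us⊆ , zs⊆ , rest = biclique (adj (blue c)) t t vs ys
        (All.zipWith (λ (eq , vs≢x) → blue-degree eq vs≢x) (few , All-resp-⊆ ys⊆ disjoint)) large′
  in false , us , zs , us⊆ , ⊆-trans zs⊆ ys⊆ , rest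
  where
  blue-degree : ∀ {x} → (t ≤ᵇ degree (adj (red c)) vs x) ≡ false → All (λ v → v ≢ x) vs →
    t ≤ degree (adj (blue c)) vs x
  blue-degree {x} eq vs≢x with double≤+⇒≤⊎≤ t (≤-reflexive (sym (trans (degree-red+blue c vs≢x) len)))
  ... | inj₁ t≤red  = contradiction (trans (sym (Equivalence.to Bool.T-≡ (≤⇒≤ᵇ t≤red))) eq) λ ()
  ... | inj₂ t≤blue = t≤blue

_∈ˡ?_ : ∀ {n} (x : Fin n) (xs : List (Fin n)) → Dec (x List.∈ xs)
_∈ˡ?_ = DecMembership._∈?_ Fin._≟_

outside : ∀ {n} → List (Fin n) → List (Fin n) → List (Fin n)
outside vs = filter (λ x → ¬? (x ∈ˡ? vs))

outside-disjoint : ∀ {n} (vs xs : List (Fin n)) → All (λ x → All (λ v → v ≢ x) vs) (outside vs xs)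
outside-disjoint vs xs = All.map (λ x∉ → All.tabulate λ v∈ v≡x → x∉ (subst (List._∈ vs) v≡x v∈))
  (All.all-filter (λ x → ¬? (x ∈ˡ? vs)) xs)

-- An edge between two common vertices would have both colours, so at most one vertex is shared.
-- Once it is met, all later vertices of `xs` lie outside `vs`.
opposite-cliques-meet : ∀ {n} (c : Coloring n) b {vs xs : List (Fin n)} →
  Clique (mono b c) vs → Clique (mono (not b) c) xs → length xs ≤ suc (length (outside vs xs))
opposite-cliques-meet c b V []                         = z≤n
opposite-cliques-meet c b {vs} V (_∷_ {x} {xs} x-xs X) = step (x ∈ˡ? vs)
  where
  clash : ∀ b → not (b xor not b) ≢ true
  clash true  ()
  clash false ()

  rest∉ : x List.∈ vs → ∀ {y} → adj (mono (not b) c) x y ≡ true → ¬ y List.∈ vs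
  rest∉ x∈ xy y∈ = clash b (trans
    (sym (adj-mono-mono c b (not b) (AllPairs-∈ (adj-symmetric (mono b c)) V x∈ y∈ (adj⇒≢ (mono (not b) c) xy)))) xy)

  step : Dec (x List.∈ vs) → suc (length xs) ≤ suc (length (outside vs (x ∷ xs)))
  step (no x∉) = s≤s (≤-trans (opposite-cliques-meet c b V X)
    (≤-reflexive (sym (cong length (filter-accept (λ x → ¬? (x ∈ˡ? vs)) x∉)))))
  step (yes x∈) = s≤s (≤-reflexive (sym (cong length (trans
    (filter-reject (λ x → ¬? (x ∈ˡ? vs)) (λ x∉ → x∉ x∈))
    (filter-all (λ x → ¬? (x ∈ˡ? vs)) (All.map (rest∉ x∈) x-xs))))))

-- Two blocks of k vertices, the edges inside and between blocks being coloured by κ.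
Pattern : ∀ {n} → Coloring n → ℕ → (Bool → Bool → Bool) → Set
Pattern {n} c k κ = Σ[ γ ∈ (Bool → Fin k → Fin n) ]
  (∀ s t u v → u ≢ v → adj (mono (κ s t) c) (γ s u) (γ t v) ≡ true)

pattern-from-lists : ∀ {n} (c : Coloring n) {k : ℕ} (κ : Bool → Bool → Bool) {xs ys : List (Fin n)} →
  κ false true ≡ κ true false → k ≤ length xs → k ≤ length ys →
  Clique (mono (κ true true) c) xs → Clique (mono (κ false false) c) ys → Complete (adj (mono (κ true false) c)) xs ys →
  Pattern c k κ
pattern-from-lists {n} c {k} κ {xs} {ys} κ-sym k≤xs k≤ys X Y full = γ , edge
  where
  γ : Bool → Fin k → Fin n
  γ true  u = lookup xs (inject≤ u k≤xs)
  γ false u = lookup ys (inject≤ u k≤ys)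

  cross : ∀ u v → adj (mono (κ true false) c) (γ true u) (γ false v) ≡ true
  cross u v = All.lookup (All.lookup full (List.∈-lookup (inject≤ u k≤xs))) (List.∈-lookup (inject≤ v k≤ys))

  edge : ∀ s t u v → u ≢ v → adj (mono (κ s t) c) (γ s u) (γ t v) ≡ true
  edge true  true  u v u≢v = AllPairs-lookup (adj-symmetric (mono (κ true true) c)) X _ _ (u≢v ∘ Fin.inject≤-injective k≤xs k≤xs u v)
  edge false false u v u≢v = AllPairs-lookup (adj-symmetric (mono (κ false false) c)) Y _ _ (u≢v ∘ Fin.inject≤-injective k≤ys k≤ys u v)
  edge true  false u v u≢v = cross u v
  edge false true  u v u≢v = subst (λ b → adj (mono b c) (γ false u) (γ true v) ≡ true) (sym κ-sym)
    (adj-symmetric (mono (κ true false) c) (cross v u))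

-- With b as the ground colour, the other colour appears on the edges between the blocks,
-- respectively inside the block indexed by true.
cutPattern cliquePattern : Bool → Bool → Bool → Bool
cutPattern    b s t = b xor (s xor t)
cliquePattern b s t = b xor (s ∧ t)

-- The colour `d` between the cliques agrees with one of them, which becomes the ground block; the
-- other clique takes the block indexed by `true`. The lists are therefore swapped when `d` is `b`.
cliquePattern-from-lists : ∀ {n} (c : Coloring n) {k : ℕ} b d {xs ys : List (Fin n)} →
  k ≤ length xs → k ≤ length ys → Clique (mono b c) xs → Clique (mono (not b) c) ys → Complete (adj (mono d c)) xs ys →
  ∃[ b′ ] Pattern c k (cliquePattern b′)
cliquePattern-from-lists c true  false k≤xs k≤ys X Y full = false , pattern-from-lists c (cliquePattern false) refl k≤xs k≤ys X Y full
cliquePattern-from-lists c false true  k≤xs k≤ys X Y full = true  , pattern-from-lists c (cliquePattern true) refl k≤xs k≤ys X Y full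
cliquePattern-from-lists c true  true  k≤xs k≤ys X Y full = true  , pattern-from-lists c (cliquePattern true) refl k≤ys k≤xs Y X
  (Complete-swap (red c) full)
cliquePattern-from-lists c false false k≤xs k≤ys X Y full = false , pattern-from-lists c (cliquePattern false) refl k≤ys k≤xs Y X
  (Complete-swap (blue c) full)

Unavoidable : ∀ {n} → Coloring n → ℕ → Set
Unavoidable c k = (∃[ b ] Pattern c k (cutPattern b)) ⊎ (∃[ b ] Pattern c k (cliquePattern b))

-- What `bipartite-ramsey` requires against 2t vertices, plus one for a vertex that the two cliques
-- may share.
starBound : ℕ → ℕ
starBound t = suc (2 * (2 ^ (2 * t) * suc t))

opposite-cliques⇒pattern : ∀ {n} (c : Coloring n) (k : ℕ) b {vs xs : List (Fin n)} →
  2 * k ≤ length vs → starBound k ≤ length xs → Clique (mono b c) vs → Clique (mono (not b) c) xs →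
  ∃[ b′ ] Pattern c k (cliquePattern b′)
opposite-cliques⇒pattern c k b {vs} {xs} 2k≤ large V X =
  let d , us , ys , us⊆ , ys⊆ , k≤us , k≤ys , full = bipartite-ramsey c k ws zs len enough (outside-disjoint ws xs)
  in cliquePattern-from-lists c b d k≤us k≤ys (AllPairs-resp-⊆ us⊆ W) (AllPairs-resp-⊆ (⊆-trans ys⊆ (filter-⊆ _ xs)) X) full
  where
  ws zs : List (Fin _)
  ws = take (2 * k) vs
  zs = outside ws xs

  W : Clique (mono b c) ws
  W = AllPairs-resp-⊆ (take-⊆ (2 * k) vs) V

  len : length ws ≡ 2 * k
  len = trans (length-take (2 * k) vs) (m≤n⇒m⊓n≡m 2k≤)

  enough : 2 * (2 ^ length ws * suc k) ≤ length zs
  enough = subst (λ l → 2 * (2 ^ l * suc k) ≤ length zs) (sym len)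
    (s≤s⁻¹ (≤-trans large (opposite-cliques-meet c b W X)))

-- A monochromatic clique found inside a part must be able to serve as a block of k vertices and
-- also as the clique of size `starBound k` facing the opposite colour.
partBound : ℕ → ℕ
partBound k = ramseyBound (2 * (k + starBound k))

-- The three summands provide for `dense`, for the first monochromatic clique of 2k vertices, and
-- for the biclique.
unavoidableBound : ℕ → ℕ
unavoidableBound k = 3 + (ramseyBound (2 * (2 * k)) + kstBound (suc (partBound k)) (partBound k))

unavoidable : ∀ {n} (c : Coloring n) (k : ℕ) → unavoidableBound k ≤ n → (∀ b → ⌊ n C 2 /2⌋ ≤ e (mono b c)) →
  Unavoidable c k
unavoidable {n} c k large half≤ = find
  where
  xs : List (Fin n)
  xs = allFin n

  unique : Unique xs
  unique = allFin⁺ n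

  length≥ : ∀ {m} → m ≤ n → m ≤ length xs
  length≥ m≤n = ≤-trans m≤n (≤-reflexive (sym (length-tabulate id)))

  ramsey≤ : ramseyBound (2 * (2 * k)) ≤ n
  ramsey≤ = m+n≤o⇒m≤o _ (m+n≤o⇒n≤o 3 large)

  kst≤ : kstBound (suc (partBound k)) (partBound k) ≤ n
  kst≤ = m+n≤o⇒n≤o (ramseyBound (2 * (2 * k))) (m+n≤o⇒n≤o 3 large)

  dense′ : ∀ b → length xs * length xs ≤ 8 * sum (map (degree (adj (mono b c)) xs) xs)
  dense′ b = ≤-trans (≤-reflexive (cong (λ l → l * l) (length-tabulate {n = n} id))) (dense (mono b c) (m+n≤o⇒m≤o 3 large) (half≤ b))

  matchCliques : ∀ {b d₁ d₂ vs us ys} → 2 * k ≤ length vs → Clique (mono b c) vs →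
    k + starBound k ≤ length us → Clique (mono d₁ c) us → k + starBound k ≤ length ys → Clique (mono d₂ c) ys →
    Complete (adj (mono (not b) c)) us ys → Unavoidable c k
  matchCliques {b} {d₁} {d₂} 2k≤ V us≥ U ys≥ Y full with d₁ Bool.≟ not b | d₂ Bool.≟ not b
  ... | yes refl | _        = inj₂ (opposite-cliques⇒pattern c k b 2k≤ (m+n≤o⇒n≤o k us≥) V U)
  ... | no _     | yes refl = inj₂ (opposite-cliques⇒pattern c k b 2k≤ (m+n≤o⇒n≤o k ys≥) V Y)
  -- Both parts carry cliques of colour b, with `not b` between them: a cut pattern. Here b appears
  -- as `not (not b)`, the form in which `¬-not` identifies `d₁` and `d₂`.
  ... | no d₁≢   | no d₂≢ with refl ← Bool.¬-not d₁≢ | refl ← Bool.¬-not d₂≢ =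
    inj₁ (not (not b) , pattern-from-lists c (cutPattern (not (not b))) refl (m+n≤o⇒m≤o k us≥) (m+n≤o⇒m≤o k ys≥)
      (subst (λ d → Clique (mono d c) _) (same b) U) (subst (λ d → Clique (mono d c) _) (same b) Y)
      (subst (λ d → Complete (adj (mono d c)) _ _) (cross b) full))
    where
    same : ∀ b → not (not b) ≡ not (not b) xor false
    same true  = refl
    same false = refl
    cross : ∀ b → not b ≡ not (not b) xor true
    cross true  = refl
    cross false = refl

  find : Unavoidable c k
  find =
    let b , vs , _ , 2k≤ , V = mono-clique c (2 * k) xs unique (length≥ ramsey≤)
        -- The biclique is taken in the colour opposite to the clique `vs`, so that a clique of that
        -- colour inside either part can be played against `vs`.
        us , ys , us⊆ , ys⊆ , us≥ , ys≥ , full = kővári-sós-turán (adj (mono (not b) c)) (partBound k) (partBound k) xs (length≥ kst≤) (dense′ (not b))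
        d₁ , us′ , us′⊆ , us′≥ , U = mono-clique c (k + starBound k) us (AllPairs-resp-⊆ us⊆ unique) (<⇒≤ us≥)
        d₂ , ys′ , ys′⊆ , ys′≥ , Y = mono-clique c (k + starBound k) ys (AllPairs-resp-⊆ ys⊆ unique) ys≥
    in matchCliques {b} {d₁} {d₂} 2k≤ V us′≥ U ys′≥ Y (All-resp-⊆ us′⊆ (All.map (All-resp-⊆ ys′⊆) full))

-- Embedding the graph into a pattern

embed : ∀ {k n} (c : Coloring n) κ → Pattern c k κ → (Fin k → Bool) → Fin k → Fin n
embed c κ (γ , _) side u = γ (side u) u

-- Distinct vertices take distinct positions, so the pattern joins their images by an edge of a
-- known colour; adjacent vertices differ, whether or not the blocks overlap.
embed-injective : ∀ {k n} (c : Coloring n) κ (pat : Pattern c k κ) (side : Fin k → Bool) → Injective _≡_ _≡_ (embed c κ pat side)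
embed-injective c κ (_ , edge) side {u} {v} eq with u Fin.≟ v
... | yes u≡v = u≡v
... | no  u≢v = contradiction eq (adj⇒≢ (mono (κ (side u) (side v)) c) (edge _ _ u v u≢v))

monoCount-embed : ∀ {k n} (G : Graph k) (c : Coloring n) κ (pat : Pattern c k κ) (side : Fin k → Bool) (d : Bool) →
  monoCount G c d (embed c κ pat side) ≡ ∑∑ (λ u v → adj G u v ∧ not (κ (side u) (side v) xor d))
monoCount-embed {k} {n} G c κ pat@(_ , edge) side d = ∑∑-cong same
  where
  f : Fin k → Fin n
  f = embed c κ pat side

  same : ∀ u v → adj G u v ∧ adj (mono d c) (f u) (f v) ≡ adj G u v ∧ not (κ (side u) (side v) xor d)
  same u v with adj G u v in uv
  ... | false = refl
  ... | true  = adj-mono-mono c (κ (side u) (side v)) d (edge _ _ u v (adj⇒≢ G uv))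

remaining-count : ∀ {i j m} x y → i + j ≡ 2 * m → i ≡ 2 * x → x + y ≡ m → j ≡ 2 * y
remaining-count {j = j} x y i+j≡ refl refl = +-cancelˡ-≡ (2 * x) j (2 * y) (trans i+j≡ (*-distribˡ-+ 2 x y))

-- One colour count determines the other, as they add up to the number of edges of `G`. Counting
-- blue instead of red exchanges the two kinds of copy.
embedding⇒copy : ∀ {k n} (G : Graph k) {r : ℕ} → r ≤ e G → (c : Coloring n) {f : Fin k → Fin n} → Injective _≡_ _≡_ f →
  ∀ d {x} → monoCount G c d f ≡ 2 * x → x ≡ r ⊎ x ≡ e G ∸ r →
  HasColoredCopy G r (e G ∸ r) c ⊎ HasColoredCopy G (e G ∸ r) r c
embedding⇒copy G {r} r≤e c {f} inj d count≡ = place d count≡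
  where
  copy : ∀ x y → monoCount G c true f ≡ 2 * x → monoCount G c false f ≡ 2 * y → HasColoredCopy G x y c
  copy x y red≡ blue≡ = Equivalence.from (copy⇔embedding G x y c) (f , inj , red≡ , blue≡)

  total : monoCount G c true f + monoCount G c false f ≡ 2 * e G
  total = monoCount-+ G c inj

  total′ : monoCount G c false f + monoCount G c true f ≡ 2 * e G
  total′ = trans (+-comm (monoCount G c false f) _) total

  place : ∀ d {x} → monoCount G c d f ≡ 2 * x → x ≡ r ⊎ x ≡ e G ∸ r →
    HasColoredCopy G r (e G ∸ r) c ⊎ HasColoredCopy G (e G ∸ r) r c
  place true  eq (inj₁ refl) = inj₁ (copy r (e G ∸ r) eq (remaining-count r (e G ∸ r) total eq (m+[n∸m]≡n r≤e)))
  place true  eq (inj₂ refl) = inj₂ (copy (e G ∸ r) r eq (remaining-count (e G ∸ r) r total eq (m∸n+n≡m r≤e)))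
  place false eq (inj₁ refl) = inj₂ (copy (e G ∸ r) r (remaining-count r (e G ∸ r) total′ eq (m+[n∸m]≡n r≤e)) eq)
  place false eq (inj₂ refl) = inj₁ (copy r (e G ∸ r) (remaining-count (e G ∸ r) r total′ eq (m∸n+n≡m r≤e)) eq)

-- In a pattern with ground colour b, the colour `not b` sits exactly where `t` holds: on the cut
-- edges, respectively on the edges inside W.
not-xor-not : ∀ b t → not ((b xor t) xor not b) ≡ t
not-xor-not true  true  = refl
not-xor-not true  false = refl
not-xor-not false true  = refl
not-xor-not false false = refl

-- For n ≥ 3 this is the largest bound that tonality admits. Exceeding it means that each colour has
-- at least ⌊C(n,2)/2⌋ edges, as `unavoidable` requires.
halfPred : ℕ → ℕ
halfPred n = pred ⌊ n C 2 /2⌋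

suc-halfPred : ∀ n → 3 ≤ n → suc (halfPred n) ≡ ⌊ n C 2 /2⌋
suc-halfPred n 3≤n = suc-pred ⌊ n C 2 /2⌋ {{>-nonZero (⌊n/2⌋-mono {2} {n C 2} (≤-trans (n≤1+n 2) (≤-trans 3≤n n≤nC2)))}}
  where
  open ≤-Reasoning
  triple : ∀ n → 3 * n ≡ 2 * n + n
  triple = solve-∀

  n≤nC2 : n ≤ n C 2
  n≤nC2 = *-cancelˡ-≤ 2 (+-cancelʳ-≤ n _ _ (begin
    2 * n + n        ≡⟨ triple n ⟨
    3 * n            ≤⟨ *-monoˡ-≤ n 3≤n ⟩
    n * n            ≡⟨ 2*nC2+n≡n*n n ⟨
    2 * (n C 2) + n  ∎))

unavoidable⇒copy : ∀ {k n} (G : Graph k) {r : ℕ} → r ≤ e G → {X Y W : Subset k} →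
  IsPartition X Y → eBetween G X Y ≡ r ⊎ eBetween G X Y ≡ e G ∸ r →
  e (graph (induced G W)) ≡ r ⊎ e (graph (induced G W)) ≡ e G ∸ r →
  (c : Coloring n) → Unavoidable c k → HasColoredCopy G r (e G ∸ r) c ⊎ HasColoredCopy G (e G ∸ r) r c
unavoidable⇒copy {k} G r≤e {X = X} part cut _ c (inj₁ (b , cuts)) =
  embedding⇒copy G r≤e c (embed-injective c (cutPattern b) cuts side) (not b)
    (trans (monoCount-embed G c (cutPattern b) cuts side (not b)) (trans
      (∑∑-cong λ u v → cong (adj G u v ∧_) (not-xor-not b (side u xor side v)))
      (sym (2*eBetween-partition G part)))) cut
  where
  side : Fin k → Bool
  side u = does (u ∈? X)
unavoidable⇒copy {k} G r≤e {W = W} _ _ clique c (inj₂ (b , cliques)) =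
  embedding⇒copy G r≤e c (embed-injective c (cliquePattern b) cliques side) (not b)
    (trans (monoCount-embed G c (cliquePattern b) cliques side (not b)) (trans
      (∑∑-cong λ u v → cong (adj G u v ∧_) (not-xor-not b (side u ∧ side v)))
      (sym (2*e≡∑∑ (graph (induced G W)))))) clique
  where
  side : Fin k → Bool
  side u = does (u ∈? W)

unavoidable⇒forces : ∀ {k} (G : Graph k) {r : ℕ} → r ≤ e G → {X Y W : Subset k} →
  IsPartition X Y → eBetween G X Y ≡ r ⊎ eBetween G X Y ≡ e G ∸ r →
  e (graph (induced G W)) ≡ r ⊎ e (graph (induced G W)) ≡ e G ∸ r →
  ∀ n → unavoidableBound k ≤ n → Forces G r n (halfPred n)
unavoidable⇒forces {k} G r≤e part cut clique n large c min> =
  unavoidable⇒copy G r≤e part cut clique c (unavoidable c k large half≤)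
  where
  half≤min : ⌊ n C 2 /2⌋ ≤ e (red c) ⊓ e (blue c)
  half≤min = ≤-trans (≤-reflexive (sym (suc-halfPred n (m+n≤o⇒m≤o 3 large)))) min>

  half≤ : ∀ b → ⌊ n C 2 /2⌋ ≤ e (mono b c)
  half≤ true  = ≤-trans half≤min (m⊓n≤m (e (red c)) (e (blue c)))
  half≤ false = ≤-trans half≤min (m⊓n≤n (e (red c)) (e (blue c)))

theorem2p4 : ∀ {k : ℕ} (G : Graph k) (r : ℕ) → 0 < r → r ≤ ⌊ e G /2⌋ →
    Tonal r G ⇔
    ((Σ[ X ∈ Subset k ] Σ[ Y ∈ Subset k ] (IsPartition X Y × (eBetween G X Y ≡ r ⊎ eBetween G X Y ≡ e G ∸ r)))
    × (Σ[ W ∈ Subset k ] (e (graph (induced G W)) ≡ r ⊎ e (graph (induced G W)) ≡ e G ∸ r)))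
theorem2p4 {k} G r 0<r r≤half = mk⇔
  (λ tonal → tonal⇒partition G r tonal , tonal⇒induced G r tonal)
  λ ((X , Y , part , cut) , (W , clique)) → unavoidableBound k , λ n large →
    -- Since `halfPred n` forces a copy, a least forcing `s` exists and is at most `halfPred n`,
    -- hence strictly below half.
    let s , bal , s≤ = least (forces? G r n) {halfPred n} (unavoidable⇒forces G (≤-trans r≤half (⌊n/2⌋≤n (e G))) part cut clique n large)
    in s , bal , ≤-trans (s≤s s≤) (≤-reflexive (suc-halfPred n (m+n≤o⇒m≤o 3 large)))
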